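{- Let $q\ge3$ and $\delta\geq1$. Then $c_{n,\delta}\sim g_{n,\delta}$ as $n\to\infty$, where $g_{n,\delta}$ is the number of rooted bipartite $(q+1)$-edge-colored graphs of order $\delta$ with $2n$ vertices and $c_{n,\delta}$ is the number of those that are SYK graphs.
   Context: A $(q+1)$-edge-colored graph is a finite connected multigraph with edge colors in $\{0,\dots,q\}$, each vertex incident to exactly one edge of each color; rooted = one color-$0$ edge distinguished and oriented; bipartite = vertices black/white with every edge joining black to white (origin of root edge black); graphs are counted up to color- and root-preserving isomorphism. Order: $\delta_0(G)=1+\frac{q-1}{2}V(G)-F_0(G)$, with $V(G)$ the number of vertices and $F_0(G)$ the total number over $i\in\{1,\dots,q\}$ of connected components (cycles) of the subgraph of edges of colors $0$ and $i$. $G$ is an SYK graph if it remains connected after deleting all color-$0$ edges. -}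

module Defs where

open import Data.Bool using (Bool; true; false; _∧_; _∨_; not; if_then_else_)
open import Data.Nat using (ℕ; zero; suc; _+_; _*_; _∸_; _≤ᵇ_; _≡ᵇ_)
open import Data.Fin using (Fin; toℕ) renaming (zero to fzero; suc to fsuc)
open import Data.Vec using (Vec; []; _∷_; lookup)
open import Data.List using (List; []; _∷_; [_]; map; concatMap; allFin; filterᵇ; length; upTo)
open import Data.Bool.ListAction using (any; all)
open import Data.Nat.ListAction using (sum)
open import Data.Product using (_×_; _,_; proj₁; proj₂)

-- Encoding of a labelled rooted bipartite (q+1)-edge-coloured graph with 2n vertices:
-- black vertices = Fin n, white vertices = Fin n; for every colour c : Fin (suc q)
-- a bijection  π_c : black → white  (black b is joined to white π_c b by the edge of colour c);
-- the root is a black vertex r (the colour-0 edge r — π_0 r, oriented from black r).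

_==_ : ∀ {n} → Fin n → Fin n → Bool
i == j = toℕ i ≡ᵇ toℕ j

allVecs : ∀ {A : Set} → List A → (n : ℕ) → List (Vec A n)
allVecs xs zero = [ [] ]
allVecs xs (suc n) = concatMap (λ x → map (x ∷_) (allVecs xs n)) xs

injectiveᵇ : ∀ {n} → Vec (Fin n) n → Bool
injectiveᵇ {n} v = all (λ i → all (λ j → not (lookup v i == lookup v j) ∨ (i == j)) (allFin n)) (allFin n)

Perms : (n : ℕ) → List (Vec (Fin n) n)
Perms n = filterᵇ injectiveᵇ (allVecs (allFin n) n)

Colouring : ℕ → ℕ → Set
Colouring n q = Vec (Vec (Fin n) n) (suc q)

RGraph : ℕ → ℕ → Set
RGraph n q = Fin n × Colouring n q

allRGraphs : (n q : ℕ) → List (RGraph n q)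
allRGraphs n q = concatMap (λ r → map (r ,_) (allVecs (Perms n) (suc q))) (allFin n)

isoᵇ : ∀ {n q} → RGraph n q → RGraph n q → Bool
isoᵇ {n} {q} (r , ps) (r' , ps') =
  any (λ α → any (λ β →
      (lookup α r == r') ∧
      all (λ c → all (λ b → lookup β (lookup (lookup ps c) b) == lookup (lookup ps' c) (lookup α b))
                     (allFin n)) (allFin (suc q)))
    (Perms n)) (Perms n)

countClasses : ∀ {A : Set} → (A → A → Bool) → List A → ℕ
countClasses {A} eq xs = go [] xs
  where
  go : List A → List A → ℕ
  go seen [] = 0
  go seen (x ∷ ys) = if any (eq x) seen then go seen ys else suc (go (x ∷ seen) ys)

-- connectivity of the subgraph with edges of the colours in the list C (all vertices kept)
-- black b, b' are at distance 2 if  π_c b = π_d b'  for some c, d ∈ C.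
reachᵇ : ∀ {n q} → Colouring n q → List (Fin (suc q)) → Fin n → ℕ → Fin n → Bool
reachᵇ ps C r zero b = r == b
reachᵇ {n} ps C r (suc k) b =
  reachᵇ ps C r k b ∨
  any (λ b' → reachᵇ ps C r k b' ∧
        any (λ c → any (λ d → lookup (lookup ps c) b' == lookup (lookup ps d) b) C) C)
      (allFin n)

-- (for nonempty C every white vertex is adjacent to a black one, so it suffices
--  that all black vertices are reachable from the root)
connectedWithᵇ : ∀ {n q} → List (Fin (suc q)) → RGraph n q → Bool
connectedWithᵇ {n} C (r , ps) = all (reachᵇ ps C r n) (allFin n)

allColours : ∀ q → List (Fin (suc q))
allColours q = allFin (suc q)

nonzeroColours : ∀ q → List (Fin (suc q))
nonzeroColours q = map fsuc (allFin q)

connectedᵇ : ∀ {n q} → RGraph n q → Bool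
connectedᵇ {n} {q} = connectedWithᵇ (allColours q)

SYKᵇ : ∀ {n q} → RGraph n q → Bool
SYKᵇ {n} {q} = connectedWithᵇ (nonzeroColours q)

invAt : ∀ {n} → Vec (Fin n) n → Fin n → Fin n → Fin n
invAt {n} v w dflt = search (allFin n)
  where
  search : List (Fin n) → Fin n
  search [] = dflt
  search (b ∷ bs) = if lookup v b == w then b else search bs

iter : ∀ {A : Set} → ℕ → (A → A) → A → A
iter zero f x = x
iter (suc k) f x = f (iter k f x)

-- number of cycles of the permutation f of Fin n (= number of points minimal in their orbit)
cycleCount : ∀ n → (Fin n → Fin n) → ℕ
cycleCount n f = length (filterᵇ (λ b → all (λ k → toℕ b ≤ᵇ toℕ (iter k f b)) (upTo n)) (allFin n))

-- number of bicoloured cycles of colours 0 and c: each such cycle alternates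
-- black b → (colour 0) white π_0 b → (colour c) black π_c⁻¹ (π_0 b), so they are the
-- cycles of the permutation π_c⁻¹ ∘ π_0 of the black vertices.
bicycles : ∀ {n q} → Colouring n q → Fin (suc q) → ℕ
bicycles {n} ps c =
  cycleCount n (λ b → invAt (lookup ps c) (lookup (lookup ps fzero) b) b)

F₀ : ∀ {n q} → RGraph n q → ℕ
F₀ {n} {q} (r , ps) = sum (map (bicycles ps) (nonzeroColours q))

-- δ₀(G) = 1 + (q-1)/2 · V(G) − F₀(G) with V(G) = 2n, i.e. δ₀(G) = δ  iff  1 + (q-1) n = F₀(G) + δ
hasOrderᵇ : ∀ {n q} → ℕ → RGraph n q → Bool
hasOrderᵇ {n} {q} δ G = (1 + (q ∸ 1) * n) ≡ᵇ (F₀ G + δ)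

g : (q n δ : ℕ) → ℕ
g q n δ = countClasses isoᵇ (filterᵇ (λ G → connectedᵇ G ∧ hasOrderᵇ δ G) (allRGraphs n q))

c : (q n δ : ℕ) → ℕ
c q n δ = countClasses isoᵇ
  (filterᵇ (λ G → connectedᵇ G ∧ hasOrderᵇ δ G ∧ SYKᵇ G) (allRGraphs n q))

-- Write σ_i = π_i⁻¹ π_0.  A graph of order δ is a transitive tuple (σ_1, …, σ_q) of permutations of the
-- n colour-0 edges; joining each of these edges to the q cycles containing it gives a connected graph of
-- cyclomatic number 1 + (q-1)n − F₀ = δ.  If deleting colour 0 disconnects the graph, let X be the set of
-- colour-0 edges with one end in a given component.  Along every cycle of every σ_i membership changes an
-- even number of times, so each cycle meeting X meets it at least twice.
--
-- Such a graph is rare because it can be altered in about n ways without remembering where it came from.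
-- Fix x ∈ X, a colour i, a second y ∈ X on the same σ_i-cycle and a fixed point z of σ_i: split that cycle
-- between x and y, then insert z into the part of x or of y, whichever keeps the graph connected.  The
-- order is unchanged, the pairs (i, z) number at least n − 2δ since σ_i-cycles are short on average, and
-- the original is recovered from the new graph, i, x, y and the part chosen.
--
-- It remains to bound the pairs (x, y) that can occur for a given new graph.  For a set U of colour-0 edges
-- let F(U) be the number of cycles meeting it.  Adding to U an edge that shares a cycle with it never
-- decreases (q-1)|U| − F(U), so connectivity bounds this quantity by δ − 1 for every nonempty U.  A set X as
-- above, with only the two cycles of x and y allowed to meet it once, has at most 2δ elements, and adjoining
-- it to U strictly increases (q-1)|U| − F(U) unless it is already contained in U, provided U contains a
-- suitable set of δ edges meeting every pair of edges that share two cycles.  Hence all such X together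
-- cover at most δ + (2δ)² edges.
--
-- Rooted connected graphs have no automorphisms, so all this may be counted on labelled graphs.

module Submission where

open import Defs
import Algebra.Properties.CommutativeMonoid.Sum
open import Data.Bool.Base using (Bool; true; false; T; if_then_else_; not; _∧_; _∨_)
import Data.Bool.Properties as Bool
open import Data.Bool.Properties using (T?; T-∧; T-∨)
open import Data.Bool.ListAction using (any; all)
open import Data.Empty using (⊥; ⊥-elim)
open import Data.Fin.Base using (Fin; zero; suc; toℕ; fromℕ<)
open import Data.Fin.Permutation.Components using (transpose)
open import Data.Fin.Properties using (_≟_; any?; ¬∀⟶∃¬; pigeonhole; toℕ<n; toℕ-fromℕ<; toℕ-injective)
import Data.Fin.Properties as Fin
open import Data.List.Base using (List; []; _∷_; [_]; _++_; length; map; concatMap; allFin; upTo; filter; filterᵇ; tabulate; cartesianProduct; cartesianProductWith)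
import Data.List.Membership.DecPropositional as DecMembership
open import Data.List.Membership.Propositional using (_∈_; _∉_; lose; find)
open import Data.List.Membership.Propositional.Properties using (∈-++⁻; ∈-++⁺ˡ; ∈-++⁺ʳ; ∈-allFin; ∈-upTo⁺; ∈-upTo⁻; ∈-map⁺; ∈-filter⁺; ∈-filter⁻; ∈-cartesianProductWith⁺; ∈-cartesianProductWith⁻; ∈-cartesianProduct⁺; ∈-cartesianProduct⁻)
open import Data.List.Properties using (length-++; length-map; length-tabulate; length-filter; filter-++; map-tabulate; map-∘)
open import Data.List.Relation.Unary.All as All using (All; []; _∷_)
import Data.List.Relation.Unary.All.Properties as All
open import Data.List.Relation.Unary.AllPairs as AllPairs using (AllPairs; []; _∷_)
import Data.List.Relation.Unary.AllPairs.Properties as AllPairs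
open import Data.List.Relation.Unary.Any as Any using (Any; here; there; _─_)
import Data.List.Relation.Unary.Any.Properties as Any
open import Data.List.Relation.Unary.Unique.Propositional using (Unique)
import Data.List.Relation.Unary.Unique.Propositional.Properties as Unique
open import Data.Nat.Base using (ℕ; zero; suc; _+_; _*_; _∸_; _≤_; _<_; _≤ᵇ_; _≡ᵇ_; z≤n; s≤s; ∣_-_∣; >-nonZero)
open import Data.Nat.DivMod using (_%_; _/_; m≡m%n+[m/n]*n; m%n<n)
open import Data.Nat.ListAction using () renaming (sum to listSum)
open import Data.Nat.Properties hiding (_≟_)
open import Data.Nat.Tactic.RingSolver using (solve-∀)
open import Data.Product.Base as Product using (∃; ∃₂; ∃-syntax; _×_; _,_; proj₁; proj₂)
open import Data.Product.Properties using (≡-dec)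
open import Data.Sum.Base as Sum using (_⊎_; inj₁; inj₂; swap)
open import Data.Vec.Base as Vec using (Vec; []; _∷_; lookup; _[_]≔_)
import Data.Vec.Properties as Vec
open import Data.Vec.Properties using (∷-injective; lookup∘update; lookup∘update′; lookup∘tabulate)
open import Function.Base using (_∘_; id)
open import Function.Bundles using (module Equivalence)
open import Function.Definitions using (Injective)
open import Level using (0ℓ)
open import Relation.Binary.Construct.Closure.ReflexiveTransitive using (Star; ε; _◅_; _◅◅_)
open import Relation.Binary.Core using (Rel)
open import Relation.Binary.Definitions using (DecidableEquality)
open import Relation.Binary.PropositionalEquality using (_≡_; _≢_; refl; sym; trans; cong; cong₂; subst; ≢-sym; module ≡-Reasoning)
open import Relation.Binary.Structures using (IsEquivalence; IsDecEquivalence)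
open import Relation.Nullary using (¬_; Dec; yes; no; does; contradiction; ¬?)
open import Relation.Nullary.Decidable using (_×-dec_; _⊎-dec_; map′; decidable-stable)
open Algebra.Properties.CommutativeMonoid.Sum +-0-commutativeMonoid using (sum; ∑-distrib-+; sum-cong-≗)
open Equivalence using (to; from)

private variable
  A B C : Set
  n q : ℕ

-- Counting in lists

length-─ : {P : A → Set} {xs : List A} (p : Any P xs) → suc (length (xs ─ p)) ≡ length xs
length-─ (here _) = refl
length-─ (there p) = cong suc (length-─ p)

any-─ : {P Q : A → Set} {xs : List A} → (∀ {y} → P y → Q y → ⊥) →
        (p : Any P xs) → Any Q xs → Any Q (xs ─ p)
any-─ dis (here px) (here qx) = ⊥-elim (dis px qx)
any-─ dis (here px) (there q) = q
any-─ dis (there p) (here qx) = here qx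
any-─ dis (there p) (there q) = there (any-─ dis p q)

-- Counting with a relation in place of an injection: `S`-related entries cannot share an
-- `R`-partner, so each partner found is struck out of `ys` before the next entry is treated. Later
-- uses take `S` to be inequality, inequivalence or having distinct keys.
length-≤-by : {S : A → A → Set} {R : A → B → Set} →
              (∀ {x x′ y} → S x x′ → R x y → R x′ y → ⊥) →
              ∀ {xs ys} → AllPairs S xs → (∀ {x} → x ∈ xs → Any (R x) ys) →
              length xs ≤ length ys
length-≤-by inj {[]} _ _ = z≤n
length-≤-by inj {x ∷ xs} {ys} (px ∷ pxs) tot =
  subst (suc (length xs) ≤_) (length-─ p)
    (s≤s (length-≤-by inj pxs λ x′∈ → any-─ (inj (All.lookup px x′∈)) p (tot (there x′∈))))
  where p = tot (here refl)

unique-⊆⇒length-≤ : {xs ys : List A} → Unique xs → (∀ {x} → x ∈ xs → x ∈ ys) →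
                    length xs ≤ length ys
unique-⊆⇒length-≤ u sub = length-≤-by (λ x≢x′ x≡y x′≡y → x≢x′ (trans x≡y (sym x′≡y))) u sub

unique-length-≤ : {xs : List (Fin n)} → Unique xs → length xs ≤ n
unique-length-≤ {n} {xs} u =
  subst (length xs ≤_) (length-tabulate id) (unique-⊆⇒length-≤ {ys = allFin n} u λ {x} _ → ∈-allFin x)

allPairs-unique : {A : Set} {_~_ : A → A → Set} → (∀ {a b} → a ~ b → b ~ a) → ∀ {xs a b} →
                  AllPairs (λ a b → ¬ a ~ b) xs → a ∈ xs → b ∈ xs → a ~ b → a ≡ b
allPairs-unique s _ (here refl) (here refl) _ = refl
allPairs-unique s (px ∷ _) (here refl) (there b∈) a~b = contradiction a~b (All.lookup px b∈)
allPairs-unique s (px ∷ _) (there a∈) (here refl) a~b = contradiction (s a~b) (All.lookup px a∈)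
allPairs-unique s (_ ∷ pxs) (there a∈) (there b∈) a~b = allPairs-unique s pxs a∈ b∈ a~b

-- Partitions and their transversals

record Partition (n : ℕ) : Set₁ where
  infix 4 _~_
  field
    _~_              : Rel (Fin n) 0ℓ
    isDecEquivalence : IsDecEquivalence _~_
  open IsDecEquivalence isDecEquivalence public
    renaming (refl to ~-refl; sym to ~-sym; trans to ~-trans; _≟_ to _~?_)
    using ()

  Meets : Fin n → List (Fin n) → Set
  Meets a = Any (a ~_)

  meets? : ∀ a xs → Dec (Meets a xs)
  meets? a = Any.any? (a ~?_)

  Independent : List (Fin n) → Set
  Independent = AllPairs (λ a b → ¬ a ~ b)

  reps : List (Fin n) → List (Fin n)
  reps [] = []
  reps (x ∷ xs) with meets? x xs
  ... | yes _ = reps xs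
  ... | no  _ = x ∷ reps xs

  reps-⊆ : ∀ xs {a} → a ∈ reps xs → a ∈ xs
  reps-⊆ (x ∷ xs) a∈ with meets? x xs
  reps-⊆ (x ∷ xs) a∈ | yes _ = there (reps-⊆ xs a∈)
  reps-⊆ (x ∷ xs) (here eq) | no _ = here eq
  reps-⊆ (x ∷ xs) (there a∈) | no _ = there (reps-⊆ xs a∈)

  reps-indep : ∀ xs → Independent (reps xs)
  reps-indep [] = []
  reps-indep (x ∷ xs) with meets? x xs
  ... | yes _ = reps-indep xs
  ... | no ¬m = All.tabulate (λ a∈ x~a → ¬m (lose (reps-⊆ xs a∈) x~a)) ∷ reps-indep xs

  meets-trans : ∀ {a b xs} → a ~ b → Meets b xs → Meets a xs
  meets-trans a~b = Any.map (~-trans a~b)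

  meets-∈ : ∀ {a xs} → a ∈ xs → Meets a xs
  meets-∈ a∈ = lose a∈ ~-refl

  reps-cover : ∀ xs {a} → a ∈ xs → Meets a (reps xs)
  reps-cover (x ∷ xs) a∈ with meets? x xs
  reps-cover (x ∷ xs) (here refl) | yes m =
    let _ , b∈ , x~b = find m in meets-trans x~b (reps-cover xs b∈)
  reps-cover (x ∷ xs) (there a∈) | yes m = reps-cover xs a∈
  reps-cover (x ∷ xs) (here refl) | no _ = here ~-refl
  reps-cover (x ∷ xs) (there a∈) | no _ = there (reps-cover xs a∈)

  independent-length-≤ : ∀ {xs ys} → Independent xs → (∀ {a} → a ∈ xs → Meets a ys) →
                         length xs ≤ length ys
  independent-length-≤ = length-≤-by λ ¬x~x′ x~y x′~y → ¬x~x′ (~-trans x~y (~-sym x′~y))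

  classes : List (Fin n) → ℕ
  classes = length ∘ reps

  classes-≤ : ∀ {xs ys} → (∀ {a} → a ∈ xs → Meets a ys) → classes xs ≤ length ys
  classes-≤ {xs} cov = independent-length-≤ (reps-indep xs) (cov ∘ reps-⊆ xs)

  meets-reps : ∀ {a xs} → Meets a xs → Meets a (reps xs)
  meets-reps {xs = xs} m = let _ , b∈ , a~b = find m in meets-trans a~b (reps-cover xs b∈)

  classes-mono : ∀ {xs ys} → (∀ {a} → a ∈ xs → Meets a ys) → classes xs ≤ classes ys
  classes-mono cov = classes-≤ (meets-reps ∘ cov)

  -- Compared with `reps xs` by `independent-length-≤` in both directions; this is how class counts
  -- are read off from explicit transversals.
  classes-transversal : ∀ {xs ts} → Independent ts → (∀ {a} → a ∈ ts → Meets a xs) →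
                        (∀ {a} → a ∈ xs → Meets a ts) → classes xs ≡ length ts
  classes-transversal ind sub cov =
    ≤-antisym (classes-≤ cov) (independent-length-≤ ind (meets-reps ∘ sub))

  classes-≤-length : ∀ xs → classes xs ≤ length xs
  classes-≤-length xs = classes-≤ {xs} {xs} meets-∈

  classes-++ : ∀ xs ys zs → (∀ {a} → a ∈ xs → Meets a ys ⊎ Meets a zs) →
               classes xs ≤ classes ys + classes zs
  classes-++ xs ys zs cov =
    subst (classes xs ≤_) (length-++ (reps ys)) (classes-≤ (λ a∈ → aux (cov a∈)))
    where
    aux : ∀ {a} → Meets a ys ⊎ Meets a zs → Meets a (reps ys ++ reps zs)
    aux (inj₁ m) = Any.++⁺ˡ (meets-reps m)
    aux (inj₂ m) = Any.++⁺ʳ (reps ys) (meets-reps m)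

  Partner : List (Fin n) → Fin n → Set
  Partner xs a = ∃ λ b → b ∈ xs × b ≢ a × a ~ b

  -- A representative and its partner are distinct, and distinct classes use disjoint pairs.
  classes-paired : ∀ {xs} → Unique xs → (∀ {a} → a ∈ xs → Partner xs a) →
                   2 * classes xs ≤ length xs
  classes-paired {xs} u pt with build (reps xs) (reps-indep xs) (reps-⊆ xs)
    where
    build : ∀ rs → Independent rs → (∀ {a} → a ∈ rs → a ∈ xs) →
            ∃ λ ps → Unique ps × length ps ≡ 2 * length rs ×
              All (λ p → Meets p rs) ps × (∀ {a} → a ∈ ps → a ∈ xs)
    build [] _ _ = [] , [] , refl , [] , λ ()
    build (r ∷ rs) (¬r ∷ ind) sub with build rs ind (sub ∘ there) | pt (sub (here refl))
    ... | ps , ups , lps , mps , sps | b , b∈ , b≢r , r~b =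
        r ∷ b ∷ ps
      , (≢-sym b≢r ∷ All.map (λ m → λ { refl → no-meet m }) mps)
        ∷ All.map (λ m → λ { refl → no-meet (meets-trans r~b m) }) mps ∷ ups
      , trans (cong (2 +_) lps) (sym (*-suc 2 (length rs)))
      , here ~-refl ∷ here (~-sym r~b) ∷ All.map there mps
      , λ { (here refl) → sub (here refl) ; (there (here refl)) → b∈ ; (there (there a∈)) → sps a∈ }
      where
      no-meet : ¬ Meets r rs
      no-meet m = let _ , s∈ , r~s = find m in All.lookup ¬r s∈ r~s
  ... | ps , ups , lps , _ , sps =
    subst (_≤ length xs) lps (unique-⊆⇒length-≤ {xs = ps} {xs} ups sps)

open Partition

length-filter-split : {P : A → Set} (P? : ∀ a → Dec (P a)) (xs : List A) →
  length (filter P? xs) + length (filter (¬? ∘ P?) xs) ≡ length xs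
length-filter-split P? [] = refl
length-filter-split P? (x ∷ xs) with P? x
... | yes _ = cong suc (length-filter-split P? xs)
... | no  _ = trans (+-suc _ _) (cong suc (length-filter-split P? xs))

-- Split `xs` by whether the class meets `ys`. The part that does has at most as many classes as it
-- has entries, and at most `length ys`. In the other part partners survive, since they lie in the
-- same class, and `classes-paired` applies.
classes-paired-except : (P : Partition n) → ∀ {xs ys} → Unique xs →
  (∀ {a} → a ∈ xs → Meets P a ys ⊎ Partner P xs a) →
  2 * classes P xs ≤ length xs + length ys
classes-paired-except P {xs} {ys} u pt = begin
  2 * classes P xs                             ≤⟨ *-monoʳ-≤ 2 (classes-++ P xs xs₁ xs₂ cov) ⟩
  2 * (classes P xs₁ + classes P xs₂)          ≡⟨ *-distribˡ-+ 2 (classes P xs₁) (classes P xs₂) ⟩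
  2 * classes P xs₁ + 2 * classes P xs₂
    ≤⟨ +-mono-≤ le₁ (classes-paired P (Unique.filter⁺ (¬? ∘ m?) u) pt₂) ⟩
  (length xs₁ + length ys) + length xs₂        ≡⟨ swap₃ (length xs₁) (length ys) (length xs₂) ⟩
  (length xs₁ + length xs₂) + length ys        ≡⟨ cong (_+ length ys) (length-filter-split m? xs) ⟩
  length xs + length ys                        ∎
  where
  open ≤-Reasoning
  swap₃ : ∀ a b c → (a + b) + c ≡ (a + c) + b
  swap₃ = solve-∀
  m? = λ a → meets? P a ys
  xs₁ = filter m? xs
  xs₂ = filter (¬? ∘ m?) xs
  cov : ∀ {a} → a ∈ xs → Meets P a xs₁ ⊎ Meets P a xs₂
  cov {a} a∈ with m? a in eq
  ... | yes m = inj₁ (meets-∈ P (∈-filter⁺ m? a∈ m))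
  ... | no ¬m = inj₂ (meets-∈ P (∈-filter⁺ (¬? ∘ m?) a∈ ¬m))
  le₁ : 2 * classes P xs₁ ≤ length xs₁ + length ys
  le₁ = +-mono-≤ (classes-≤-length P xs₁)
          (subst (_≤ length ys) (sym (+-identityʳ _)) (classes-≤ P (proj₂ ∘ ∈-filter⁻ m? {xs = xs})))
  pt₂ : ∀ {a} → a ∈ xs₂ → Partner P xs₂ a
  pt₂ a∈ with ∈-filter⁻ (¬? ∘ m?) {xs = xs} a∈
  ... | a∈xs , ¬m with pt a∈xs
  ...   | inj₁ m = contradiction m ¬m
  ...   | inj₂ (b , b∈ , b≢a , a~b) = b , ∈-filter⁺ (¬? ∘ m?) b∈ (¬m ∘ meets-trans P a~b) , b≢a , a~b

-- Families of partitions: the order of a set of colour-0 edges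

sum-mono-≤ : {f h : Fin q → ℕ} → (∀ j → f j ≤ h j) → sum f ≤ sum h
sum-mono-≤ {zero} _ = z≤n
sum-mono-≤ {suc q} f≤h = +-mono-≤ (f≤h zero) (sum-mono-≤ (f≤h ∘ suc))

sum-const : ∀ q k → sum {q} (λ _ → k) ≡ q * k
sum-const zero k = refl
sum-const (suc q) k = cong (k +_) (sum-const q k)

sum-*ˡ : ∀ k (f : Fin q → ℕ) → sum (λ j → k * f j) ≡ k * sum f
sum-*ˡ {zero} k f = sym (*-zeroʳ k)
sum-*ˡ {suc q} k f = trans (cong (k * f zero +_) (sum-*ˡ k (f ∘ suc))) (sym (*-distribˡ-+ k (f zero) _))

single : Fin q → ℕ → Fin q → ℕ
single i k j = if does (i ≟ j) then k else 0

sum-single : (i : Fin q) (k : ℕ) → sum (single i k) ≡ k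
sum-single {suc q} zero k = trans (cong (k +_) (trans (sum-const q 0) (*-zeroʳ q))) (+-identityʳ k)
sum-single {suc q} (suc i) k = sum-single i k

_∈?_ : (a : Fin n) (xs : List (Fin n)) → Dec (a ∈ xs)
_∈?_ = DecMembership._∈?_ _≟_

module _ (P : Partition n) where

  classes-∷-meets : ∀ {a U} → Meets P a U → classes P (a ∷ U) ≡ classes P U
  classes-∷-meets {a} {U} m with meets? P a U
  ... | yes _ = refl
  ... | no ¬m = contradiction m ¬m

  classes-∷-≤ : ∀ a U → classes P (a ∷ U) ≤ suc (classes P U)
  classes-∷-≤ a U with meets? P a U
  ... | yes _ = n≤1+n _
  ... | no  _ = ≤-refl

-- The q partitions into bicoloured cycles; totalClasses on all of Fin n is F₀.
module Family {n q : ℕ} (E : Fin q → Partition n) where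

  -- Connectedness as an induction principle: a property that passes along all classes and holds
  -- somewhere holds everywhere.
  Connected : Set₁
  Connected = (P : Fin n → Set) → (∀ j {a b} → _~_ (E j) a b → P a → P b) → ∀ {a b} → P a → P b

  totalClasses : List (Fin n) → ℕ
  totalClasses U = sum (λ j → classes (E j) U)

  totalClasses-mono : ∀ {xs ys} → (∀ {a} → a ∈ xs → a ∈ ys) → totalClasses xs ≤ totalClasses ys
  totalClasses-mono {xs} {ys} sub = sum-mono-≤ λ j → classes-mono (E j) {xs} {ys} (meets-∈ (E j) ∘ sub)

  totalClasses-≤ : ∀ xs → totalClasses xs ≤ q * length xs
  totalClasses-≤ xs = subst (totalClasses xs ≤_) (sum-const q (length xs))
      (sum-mono-≤ λ j → classes-≤-length (E j) xs)

  -- `a` creates at most one class in each of the `q` colours, and none in colour `i`, where its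
  -- class is already met.
  totalClasses-∷ : ∀ {a U i} → Meets (E i) a U → totalClasses (a ∷ U) + 1 ≤ q + totalClasses U
  totalClasses-∷ {a} {U} {i} m = begin
    totalClasses (a ∷ U) + 1
      ≡⟨ cong (totalClasses (a ∷ U) +_) (sym (sum-single i 1)) ⟩
    totalClasses (a ∷ U) + sum (single i 1)              ≡⟨ sym (∑-distrib-+ _ (single i 1)) ⟩
    sum (λ j → classes (E j) (a ∷ U) + single i 1 j)     ≤⟨ sum-mono-≤ step ⟩
    sum (λ j → 1 + classes (E j) U)                      ≡⟨ ∑-distrib-+ (λ _ → 1) (λ j → classes (E j) U) ⟩
    sum {q} (λ _ → 1) + totalClasses U
      ≡⟨ cong (_+ totalClasses U) (trans (sum-const q 1) (*-identityʳ q)) ⟩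
    q + totalClasses U                                   ∎
    where
    open ≤-Reasoning
    step : ∀ j → classes (E j) (a ∷ U) + single i 1 j ≤ 1 + classes (E j) U
    step j with i ≟ j
    ... | yes refl = ≤-reflexive (trans (cong (_+ 1) (classes-∷-meets (E i) m)) (+-comm _ 1))
    ... | no  _    = ≤-trans (≤-reflexive (+-identityʳ _)) (classes-∷-≤ (E j) a U)

  totalClasses-∷₂ : ∀ {a U i k} → i ≢ k → Meets (E i) a U → Meets (E k) a U →
                    totalClasses (a ∷ U) + 2 ≤ q + totalClasses U
  totalClasses-∷₂ {a} {U} {i} {k} i≢k mᵢ mₖ = begin
    totalClasses (a ∷ U) + 2
      ≡⟨ cong (totalClasses (a ∷ U) +_) (sym (cong₂ _+_ (sum-single i 1) (sum-single k 1))) ⟩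
    totalClasses (a ∷ U) + (sum (single i 1) + sum (single k 1))
      ≡⟨ cong (totalClasses (a ∷ U) +_) (sym (∑-distrib-+ (single i 1) (single k 1))) ⟩
    totalClasses (a ∷ U) + sum (λ j → single i 1 j + single k 1 j)
      ≡⟨ sym (∑-distrib-+ _ (λ j → single i 1 j + single k 1 j)) ⟩
    sum (λ j → classes (E j) (a ∷ U) + (single i 1 j + single k 1 j))     ≤⟨ sum-mono-≤ step ⟩
    sum (λ j → 1 + classes (E j) U)                      ≡⟨ ∑-distrib-+ (λ _ → 1) (λ j → classes (E j) U) ⟩
    sum {q} (λ _ → 1) + totalClasses U
      ≡⟨ cong (_+ totalClasses U) (trans (sum-const q 1) (*-identityʳ q)) ⟩
    q + totalClasses U                                   ∎
    where
    open ≤-Reasoning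
    step : ∀ j → classes (E j) (a ∷ U) + (single i 1 j + single k 1 j) ≤ 1 + classes (E j) U
    step j with i ≟ j | k ≟ j
    ... | yes refl | yes refl = contradiction refl i≢k
    ... | yes refl | no _ = ≤-reflexive (trans (cong (_+ 1) (classes-∷-meets (E i) mᵢ)) (+-comm _ 1))
    ... | no _ | yes refl = ≤-reflexive (trans (cong (_+ 1) (classes-∷-meets (E k) mₖ)) (+-comm _ 1))
    ... | no _ | no _ = ≤-trans (≤-reflexive (+-identityʳ _)) (classes-∷-≤ (E j) a U)

  -- A nonempty proper subset can always be enlarged by an element sharing a class with it, for
  -- otherwise membership would be closed under all classes. An invariant kept by such enlargements
  -- therefore reaches the full set.
  grow : Connected → (Q : List (Fin n) → Set) →
         (∀ {a U} → a ∉ U → (∃ λ j → Meets (E j) a U) → Q U → Q (a ∷ U)) →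
         ∀ {u U} → Unique (u ∷ U) → Q (u ∷ U) →
         ∃ λ W → Q W × Unique W × (∀ a → a ∈ W)
  grow conn Q step {u} {U} uniq QU = go n uniq QU (≤-trans (m≤m+n n _) ≤-refl)
    where
    -- The fuel `m` bounds the number of missing elements: at `m = 0` the repetition-free list
    -- `u ∷ U` would have more than `n` entries.
    go : ∀ m {u U} → Unique (u ∷ U) → Q (u ∷ U) → n ≤ m + length U → ∃ λ W → Q W × Unique W × (∀ a → a ∈ W)
    go m {u} {U} uniq QU le with any? (λ a → ¬? (a ∈? (u ∷ U)) ×-dec any? (λ j → meets? (E j) a (u ∷ U)))
    ... | no ¬a = u ∷ U , QU , uniq , λ a → conn (_∈ (u ∷ U)) closed (here refl)
      where
      closed : ∀ j {a b} → _~_ (E j) a b → a ∈ (u ∷ U) → b ∈ (u ∷ U)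
      closed j {a} {b} a~b a∈ with b ∈? (u ∷ U)
      ... | yes b∈ = b∈
      ... | no  b∉ = contradiction (b , b∉ , j , lose a∈ (~-sym (E j) a~b)) ¬a
    go zero {u} {U} uniq QU le | yes _ = contradiction (≤-trans (s≤s le) (unique-length-≤ uniq)) (<-irrefl refl)
    go (suc m) {u} {U} uniq QU le | yes (a , a∉ , touch) =
      go m (All.¬Any⇒All¬ _ a∉ ∷ uniq) (step a∉ touch QU) (subst (n ≤_) (sym (+-suc m _)) le)

  DoublePair : Fin n → Fin n → Set
  DoublePair a b = ∃₂ λ j k → j ≢ k × _~_ (E j) a b × _~_ (E k) a b

  doublePair-sym : ∀ {a b} → DoublePair a b → DoublePair b a
  doublePair-sym (j , k , j≢k , p , r) = j , k , j≢k , ~-sym (E j) p , ~-sym (E k) r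

  -- What remains of the set X of colour-0 edges cut by a disconnection when x and y
  -- have been separated in colour i.
  record AlmostPaired (X : List (Fin n)) : Set where
    field
      colour : Fin q
      x y    : Fin n
      unique : Unique X
      paired : ∀ {j a} → j ≢ colour → a ∈ X → Partner (E j) X a
      except : ∀ {a} → a ∈ X → Meets (E colour) a (x ∷ y ∷ []) ⊎ Partner (E colour) X a

-- Sets of colour-0 edges in a connected family of order δ

module Ordered {n t δ : ℕ} (E : Fin (3 + t) → Partition n) (conn : Family.Connected E)
               (order : Family.totalClasses E (allFin n) + δ ≡ 1 + (2 + t) * n) where
  open Family E

  private p = 2 + t

  full-total : ∀ {W} → (∀ a → a ∈ W) → totalClasses W ≡ totalClasses (allFin n)
  full-total {W} full = ≤-antisym (totalClasses-mono {W} λ {a} _ → ∈-allFin a)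
      (totalClasses-mono {allFin n} {W} λ {a} _ → full a)

  full-length : ∀ {W : List (Fin n)} → Unique W → (∀ a → a ∈ W) → length W ≡ n
  full-length {W} u full = ≤-antisym (unique-length-≤ u)
    (subst (_≤ length W) (length-tabulate id) (unique-⊆⇒length-≤ {xs = allFin n} {W}
        (Unique.allFin⁺ n) λ {a} _ → full a))

  -- An element sharing a class with `W` adds at most `p` classes, so
  -- `p * length W - totalClasses W` never decreases along `grow`; on the full set it equals `δ - 1`
  -- by `order`.
  subset-order : ∀ {u U} → Unique (u ∷ U) → p * length (u ∷ U) + 1 ≤ totalClasses (u ∷ U) + δ
  subset-order {u} {U} uniq
    with grow conn (λ W → p * length (u ∷ U) + totalClasses W ≤ totalClasses (u ∷ U) + p * length W)
           (λ {a} {W} _ touch → step {a} {W} touch) uniq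
           (≤-reflexive (+-comm (p * length (u ∷ U)) _))
    where
    step : ∀ {a W} → (∃ λ j → Meets (E j) a W) →
           p * length (u ∷ U) + totalClasses W ≤ totalClasses (u ∷ U) + p * length W →
           p * length (u ∷ U) + totalClasses (a ∷ W) ≤ totalClasses (u ∷ U) + p * suc (length W)
    step {a} {W} (j , m) le = begin
      L + totalClasses (a ∷ W)
        ≤⟨ +-monoʳ-≤ L (+-cancelʳ-≤ 1 _ _ (≤-trans (totalClasses-∷ m)
            (≤-reflexive (+-comm 1 (p + totalClasses W))))) ⟩
      L + (p + totalClasses W)     ≡⟨ shuffle L p (totalClasses W) ⟩
      p + (L + totalClasses W)     ≤⟨ +-monoʳ-≤ p le ⟩
      p + (K + p * length W)       ≡⟨ shuffle p K (p * length W) ⟩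
      K + (p + p * length W)       ≡⟨ cong (K +_) (sym (*-suc p (length W))) ⟩
      K + p * suc (length W)       ∎
      where
      open ≤-Reasoning
      L = p * length (u ∷ U)
      K = totalClasses (u ∷ U)
      shuffle : ∀ a b c → a + (b + c) ≡ b + (a + c)
      shuffle = solve-∀
  ... | W , QW , uW , full rewrite full-length uW full | full-total full =
    +-cancelʳ-≤ (totalClasses (allFin n)) _ _ (begin
      (L + 1) + N          ≡⟨ sh₁ L N ⟩
      1 + (L + N)          ≤⟨ +-monoʳ-≤ 1 QW ⟩
      1 + (K + p * n)      ≡⟨ sh₂ K (p * n) ⟩
      K + (1 + p * n)      ≡⟨ cong (K +_) (sym order) ⟩
      K + (N + δ)          ≡⟨ sh₃ K N δ ⟩
      (K + δ) + N          ∎)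
    where
    open ≤-Reasoning
    L = p * length (u ∷ U)
    K = totalClasses (u ∷ U)
    N = totalClasses (allFin n)
    sh₁ : ∀ a b → (a + 1) + b ≡ 1 + (a + b)
    sh₁ = solve-∀
    sh₂ : ∀ a b → 1 + (a + b) ≡ a + (1 + b)
    sh₂ = solve-∀
    sh₃ : ∀ a b c → a + (b + c) ≡ (a + c) + b
    sh₃ = solve-∀

  HitsDoublePairs : List (Fin n) → List (Fin n) → Set
  HitsDoublePairs W Γ = ∀ {a b} → a ∈ W → b ∈ W → a ≢ b → DoublePair a b → a ∈ Γ ⊎ b ∈ Γ

  -- While a set `W` grows from one element, `Γ` collects each added element that meets `W` in two
  -- different colours; the others form no double pair with earlier elements. The quantity
  -- `p * length W - totalClasses W` starts at `-1` or more, rises with every collected element and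
  -- ends at `δ - 1`, so `Γ` has at most `δ` entries.
  doublePairs-hitting-set : Fin n → ∃ λ Γ → Unique Γ × length Γ ≤ δ × HitsDoublePairs (allFin n) Γ
  doublePairs-hitting-set u with grow conn Q (λ {a} {W} → step {a} {W}) ([] ∷ []) start
    where
    Q : List (Fin n) → Set
    Q W = ∃ λ Γ → Unique Γ × (∀ {a} → a ∈ Γ → a ∈ W) × (totalClasses W + length Γ ≤ p * length W + 1) × HitsDoublePairs W Γ
    start : Q (u ∷ [])
    start = [] , [] , (λ ()) , ≤-trans (≤-reflexive (+-identityʳ _))
        (≤-trans (totalClasses-≤ (u ∷ [])) (≤-reflexive (e t)))
          , λ { (here refl) (here refl) a≢a _ → contradiction refl a≢a }
      where e : ∀ t → (3 + t) * 1 ≡ (2 + t) * 1 + 1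
            e = solve-∀
    step : ∀ {a W} → a ∉ W → (∃ λ j → Meets (E j) a W) → Q W → Q (a ∷ W)
    step {a} {W} a∉ (i , m) (Γ , uΓ , Γ⊆ , le , hits)
      with any? (λ j → any? (λ k → ¬? (j ≟ k) ×-dec (meets? (E j) a W ×-dec meets? (E k) a W)))
    ... | yes (j , k , j≢k , mⱼ , mₖ) =
        a ∷ Γ , All.¬Any⇒All¬ _ (a∉ ∘ Γ⊆) ∷ uΓ , (λ { (here e) → here e ; (there b∈) → there (Γ⊆ b∈) })
      , +-cancelʳ-≤ 1 _ _ (begin
          (totalClasses (a ∷ W) + suc (length Γ)) + 1    ≡⟨ sh₁ (totalClasses (a ∷ W)) (length Γ) ⟩
          (totalClasses (a ∷ W) + 2) + length Γ          ≤⟨ +-monoˡ-≤ (length Γ) (totalClasses-∷₂ j≢k mⱼ mₖ) ⟩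
          ((1 + p) + totalClasses W) + length Γ          ≡⟨ +-assoc (1 + p) (totalClasses W) (length Γ) ⟩
          (1 + p) + (totalClasses W + length Γ)          ≤⟨ +-monoʳ-≤ (1 + p) le ⟩
          (1 + p) + (p * length W + 1)                   ≡⟨ sh₂ p (length W) ⟩
          (p * suc (length W) + 1) + 1                   ∎)
      , λ { (here refl) _ _ _ → inj₁ (here refl)
          ; (there _) (here refl) _ _ → inj₂ (here refl)
          ; (there b∈) (there c∈) b≢c d → wk (hits b∈ c∈ b≢c d) }
      where
      open ≤-Reasoning
      sh₁ : ∀ a b → (a + suc b) + 1 ≡ (a + 2) + b
      sh₁ = solve-∀
      sh₂ : ∀ p l → (1 + p) + (p * l + 1) ≡ (p * suc l + 1) + 1
      sh₂ = solve-∀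
      wk : ∀ {b c} → b ∈ Γ ⊎ c ∈ Γ → b ∈ (a ∷ Γ) ⊎ c ∈ (a ∷ Γ)
      wk (inj₁ r) = inj₁ (there r)
      wk (inj₂ r) = inj₂ (there r)
    ... | no ¬jk = Γ , uΓ , there ∘ Γ⊆
      , +-cancelʳ-≤ 1 _ _ (begin
          (totalClasses (a ∷ W) + length Γ) + 1          ≡⟨ sh₁ (totalClasses (a ∷ W)) (length Γ) ⟩
          (totalClasses (a ∷ W) + 1) + length Γ          ≤⟨ +-monoˡ-≤ (length Γ) (totalClasses-∷ m) ⟩
          ((1 + p) + totalClasses W) + length Γ          ≡⟨ +-assoc (1 + p) (totalClasses W) (length Γ) ⟩
          (1 + p) + (totalClasses W + length Γ)          ≤⟨ +-monoʳ-≤ (1 + p) le ⟩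
          (1 + p) + (p * length W + 1)                   ≡⟨ sh₂ p (length W) ⟩
          (p * suc (length W) + 1) + 1                   ∎)
      , λ { (here refl) (here refl) a≢a _ → contradiction refl a≢a
          ; (here refl) (there c∈) _ d → contradiction d (not-double c∈)
          ; (there b∈) (here refl) _ d → contradiction (doublePair-sym d) (not-double b∈)
          ; (there b∈) (there c∈) b≢c d → hits b∈ c∈ b≢c d }
      where
      open ≤-Reasoning
      sh₁ : ∀ a b → (a + b) + 1 ≡ (a + 1) + b
      sh₁ = solve-∀
      sh₂ : ∀ p l → (1 + p) + (p * l + 1) ≡ (p * suc l + 1) + 1
      sh₂ = solve-∀
      not-double : ∀ {b} → b ∈ W → ¬ DoublePair a b
      not-double b∈ (j , k , j≢k , aⱼb , aₖb) = ¬jk (j , k , j≢k , lose b∈ aⱼb , lose b∈ aₖb)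
  ... | W , (Γ , uΓ , _ , le , hits) , uW , full rewrite full-length uW full | full-total full =
    Γ , uΓ , +-cancelˡ-≤ (totalClasses (allFin n)) _ _
      (≤-trans le (≤-reflexive (trans (+-comm (p * n) 1) (sym order))))
    , λ {a} {b} _ _ → hits (full a) (full b)

  -- Pairing allows each colour at most half of `length X` classes; the two exceptional classes cost
  -- 2 after doubling, in one colour only.
  almostPaired-total : ∀ {X} → AlmostPaired X → 2 * totalClasses X ≤ (1 + p) * length X + 2
  almostPaired-total {X} ap = begin
    2 * totalClasses X                          ≡⟨ sym (sum-*ˡ 2 (λ j → classes (E j) X)) ⟩
    sum (λ j → 2 * classes (E j) X)             ≤⟨ sum-mono-≤ step ⟩
    sum (λ j → length X + single colour 2 j)    ≡⟨ ∑-distrib-+ (λ _ → length X) (single colour 2) ⟩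
    sum {1 + p} (λ _ → length X) + sum (single colour 2)
      ≡⟨ cong₂ _+_ (sum-const (1 + p) (length X)) (sum-single colour 2) ⟩
    (1 + p) * length X + 2                      ∎
    where
    open ≤-Reasoning
    open AlmostPaired ap
    step : ∀ j → 2 * classes (E j) X ≤ length X + single colour 2 j
    step j with colour ≟ j
    ... | yes refl = classes-paired-except (E j) {ys = x ∷ y ∷ []} unique except
    ... | no i≢j = ≤-trans (classes-paired (E j) unique (paired (≢-sym i≢j))) (m≤m+n _ 0)

  -- Doubling `subset-order` and inserting `almostPaired-total` leaves `(1 + t) * length X ≤ 2 * δ`.
  almostPaired-length : ∀ {X} → AlmostPaired X → length X ≤ 2 * δ
  almostPaired-length {[]} _ = z≤n
  almostPaired-length {X@(_ ∷ _)} ap = ≤-trans (m≤m+n l (t * l)) (+-cancelʳ-≤ ((3 + t) * l + 2) _ _ (begin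
    (l + t * l) + ((3 + t) * l + 2)     ≡⟨ sh₁ t l ⟩
    2 * ((2 + t) * l + 1)               ≤⟨ *-monoʳ-≤ 2 (subset-order (AlmostPaired.unique ap)) ⟩
    2 * (totalClasses X + δ)            ≡⟨ *-distribˡ-+ 2 (totalClasses X) δ ⟩
    2 * totalClasses X + 2 * δ          ≤⟨ +-monoˡ-≤ (2 * δ) (almostPaired-total ap) ⟩
    ((3 + t) * l + 2) + 2 * δ           ≡⟨ +-comm ((3 + t) * l + 2) (2 * δ) ⟩
    2 * δ + ((3 + t) * l + 2)           ∎))
    where
    open ≤-Reasoning
    l = length X
    sh₁ : ∀ t l → (l + t * l) + ((3 + t) * l + 2) ≡ 2 * ((2 + t) * l + 1)
    sh₁ = solve-∀

  module Extend {Γ : List (Fin n)} (hits : HitsDoublePairs (allFin n) Γ)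
                {U : List (Fin n)} (Γ⊆U : ∀ {a} → a ∈ Γ → a ∈ U)
                {X : List (Fin n)} (ap : AlmostPaired X) where
    open AlmostPaired ap

    ∉U? : ∀ a → Dec (a ∉ U)
    ∉U? a = ¬? (a ∈? U)

    new : List (Fin n)
    new = filter ∉U? X

    fresh? : ∀ j a → Dec (¬ Meets (E j) a U)
    fresh? j a = ¬? (meets? (E j) a U)

    -- The entries of `X` whose class in colour `j` misses `U`: they carry exactly the classes of
    -- that colour which adjoining `X` adds to those met by `U`.
    fresh : Fin (1 + p) → List (Fin n)
    fresh j = filter (fresh? j) new

    unique-fresh : ∀ j → Unique (fresh j)
    unique-fresh j = Unique.filter⁺ (fresh? j) (Unique.filter⁺ ∉U? unique)

    fresh⊆new : ∀ j {a} → a ∈ fresh j → a ∈ new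
    fresh⊆new j = proj₁ ∘ ∈-filter⁻ (fresh? j) {xs = new}

    fresh⊆X : ∀ j {a} → a ∈ fresh j → a ∈ X
    fresh⊆X j = proj₁ ∘ ∈-filter⁻ ∉U? {xs = X} ∘ fresh⊆new j

    -- A partner lies in the same class, which misses `U`; so the partner is outside `U` and fresh
    -- too, and the pairing of `X` restricts to the fresh entries.
    partner-fresh : ∀ j {a} → a ∈ fresh j → Partner (E j) X a → Partner (E j) (fresh j) a
    partner-fresh j a∈ (b , b∈ , b≢a , a~b) =
      b , ∈-filter⁺ (fresh? j) (∈-filter⁺ ∉U? b∈ (¬m ∘ meets-trans (E j) a~b ∘ meets-∈ (E j)))
          (¬m ∘ meets-trans (E j) a~b) , b≢a , a~b
      where ¬m = proj₂ (∈-filter⁻ (fresh? j) {xs = new} a∈)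

    length-fresh : ∀ j → length (fresh j) ≤ length new
    length-fresh j = length-filter (fresh? j) new

    fresh-partner : ∀ {j} → j ≢ colour → ∀ {a} → a ∈ fresh j → Partner (E j) (fresh j) a
    fresh-partner {j} j≢i a∈ = partner-fresh j a∈ (paired j≢i (fresh⊆X j a∈))

    fresh-paired : ∀ {j} → j ≢ colour → 2 * classes (E j) (fresh j) ≤ length new
    fresh-paired {j} j≢i = ≤-trans (classes-paired (E j) (unique-fresh j) (fresh-partner j≢i)) (length-fresh j)

    fresh-colour : 2 * classes (E colour) (fresh colour) ≤ length new + 2
    fresh-colour = ≤-trans (classes-paired-except (E colour) {ys = x ∷ y ∷ []} (unique-fresh colour) aux)
                     (+-monoˡ-≤ 2 (length-fresh colour))
      where
      aux : ∀ {a} → a ∈ fresh colour → Meets (E colour) a (x ∷ y ∷ []) ⊎ Partner (E colour) (fresh colour) a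
      aux a∈ with except (fresh⊆X colour a∈)
      ... | inj₁ m = inj₁ m
      ... | inj₂ pt = inj₂ (partner-fresh colour a∈ pt)

    newClasses : ℕ
    newClasses = sum (λ j → classes (E j) (fresh j))

    total-extend : totalClasses (new ++ U) ≤ newClasses + totalClasses U
    total-extend = ≤-trans (sum-mono-≤ λ j → classes-++ (E j) (new ++ U) (fresh j) U (cov j))
                     (≤-reflexive (∑-distrib-+ (λ j → classes (E j) (fresh j)) (λ j → classes (E j) U)))
      where
      cov : ∀ j {a} → a ∈ (new ++ U) → Meets (E j) a (fresh j) ⊎ Meets (E j) a U
      cov j {a} a∈ with meets? (E j) a U | ∈-++⁻ new a∈
      ... | yes m | _ = inj₂ m
      ... | no ¬m | inj₁ a∈new = inj₁ (meets-∈ (E j) (∈-filter⁺ (fresh? j) a∈new ¬m))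
      ... | no ¬m | inj₂ a∈U = contradiction (meets-∈ (E j) a∈U) ¬m

    new∉U : ∀ {a} → a ∈ new → a ∉ U
    new∉U = proj₂ ∘ ∈-filter⁻ ∉U? {xs = X}

    no-doublePair : ∀ {a b} → a ∈ new → b ∈ new → a ≢ b → ¬ DoublePair a b
    no-doublePair {a} {b} a∈ b∈ a≢b d with hits (∈-allFin a) (∈-allFin b) a≢b d
    ... | inj₁ a∈Γ = new∉U a∈ (Γ⊆U a∈Γ)
    ... | inj₂ b∈Γ = new∉U b∈ (Γ⊆U b∈Γ)

    -- A single entry has no partner, so only the exceptional colour can contribute a class.
    bound₁ : length new ≡ 1 → newClasses ≤ 1
    bound₁ eq = subst (newClasses ≤_) (sum-single colour 1) (sum-mono-≤ step)
      where
      step : ∀ j → classes (E j) (fresh j) ≤ single colour 1 j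
      step j with colour ≟ j
      ... | yes refl = ≤-trans (classes-≤-length (E j) (fresh j))
          (subst (length (fresh j) ≤_) eq (length-fresh j))
      ... | no i≢j = ≤-pred (*-cancelˡ-< 2 _ 1 (s≤s (subst (2 * classes (E j) (fresh j) ≤_) eq
          (fresh-paired (≢-sym i≢j)))))

    -- The exceptional colour gives at most two classes. Another colour gives one only if `a` and
    -- `b` are related in it, and two such colours would make them a double pair, which is ruled out
    -- because `Γ` lies in `U`.
    bound₂ : ∀ {a b} → new ≡ a ∷ b ∷ [] → newClasses ≤ 3
    bound₂ {a} {b} eq = case
      where
      a∈ : a ∈ new
      a∈ = subst (a ∈_) (sym eq) (here refl)
      b∈ : b ∈ new
      b∈ = subst (b ∈_) (sym eq) (there (here refl))
      a≢b : a ≢ b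
      a≢b with subst Unique eq (Unique.filter⁺ ∉U? unique)
      ... | (a≢b ∷ []) ∷ _ = a≢b

      related : ∀ {j c d} → c ∈ (a ∷ b ∷ []) → d ∈ (a ∷ b ∷ []) → d ≢ c → _~_ (E j) c d → _~_ (E j) a b
      related (here refl) (here refl) d≢c _ = contradiction refl d≢c
      related (here refl) (there (here refl)) _ c~d = c~d
      related {j} (there (here refl)) (here refl) _ c~d = ~-sym (E j) c~d
      related (there (here refl)) (there (here refl)) d≢c _ = contradiction refl d≢c

      unrelated : ∀ {j} → j ≢ colour → ¬ _~_ (E j) a b → classes (E j) (fresh j) ≤ 0
      unrelated {j} j≢i ¬a~b = classes-≤ (E j) {fresh j} {[]} λ {c} c∈ →
        let d , d∈ , d≢c , c~d = fresh-partner j≢i c∈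
        in contradiction (related {j} (subst (c ∈_) eq (fresh⊆new j c∈))
            (subst (d ∈_) eq (fresh⊆new j d∈)) d≢c c~d) ¬a~b

      at-colour : ∀ {j} → classes (E j) (fresh j) ≤ 2
      at-colour {j} = ≤-trans (classes-≤-length (E j) (fresh j))
          (subst (length (fresh j) ≤_) (cong length eq) (length-fresh j))

      case : newClasses ≤ 3
      case with any? (λ k → ¬? (k ≟ colour) ×-dec _~?_ (E k) a b)
      ... | no ¬k = ≤-trans (subst (newClasses ≤_) (sum-single colour 2) (sum-mono-≤ step)) (n≤1+n 2)
        where
        step : ∀ j → classes (E j) (fresh j) ≤ single colour 2 j
        step j with colour ≟ j
        ... | yes refl = at-colour
        ... | no i≢j = unrelated (≢-sym i≢j) λ a~b → ¬k (j , ≢-sym i≢j , a~b)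
      ... | yes (k , k≢i , a~b) =
        subst (newClasses ≤_) (trans (∑-distrib-+ (single colour 2) (single k 1))
            (cong₂ _+_ (sum-single colour 2) (sum-single k 1)))
          (sum-mono-≤ step)
        where
        step : ∀ j → classes (E j) (fresh j) ≤ single colour 2 j + single k 1 j
        step j with colour ≟ j | k ≟ j
        ... | yes refl | _ = ≤-trans at-colour (m≤m+n 2 _)
        ... | no i≢j | yes refl = *-cancelˡ-≤ 2 (≤-trans (fresh-paired (≢-sym i≢j))
            (≤-reflexive (cong length eq)))
        ... | no i≢j | no k≢j = unrelated (≢-sym i≢j) λ a~ⱼb → no-doublePair a∈ b∈ a≢b
            (k , j , k≢j , a~b , a~ⱼb)

    -- Averaging: pairing gives `2 * newClasses ≤ (3 + t) * l + 2`, which is below `2 * (p * l)`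
    -- once `(1 + t) * l` exceeds 2. Shorter lengths are left to `bound₁` and `bound₂`.
    bound₃ : 3 ≤ length new → newClasses < p * length new
    bound₃ 3≤l = *-cancelˡ-< 2 _ _ (begin-strict
      2 * newClasses                          ≡⟨ sym (sum-*ˡ 2 (λ j → classes (E j) (fresh j))) ⟩
      sum (λ j → 2 * classes (E j) (fresh j)) ≤⟨ sum-mono-≤ step ⟩
      sum (λ j → l + single colour 2 j)       ≡⟨ ∑-distrib-+ (λ _ → l) (single colour 2) ⟩
      sum {1 + p} (λ _ → l) + sum (single colour 2) ≡⟨ cong₂ _+_ (sum-const (1 + p) l) (sum-single colour 2) ⟩
      (3 + t) * l + 2                         <⟨ +-monoʳ-< ((3 + t) * l) (≤-trans 3≤l (m≤m+n l (t * l))) ⟩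
      (3 + t) * l + (l + t * l)               ≡⟨ sh t l ⟩
      2 * (p * l)                             ∎)
      where
      open ≤-Reasoning
      l = length new
      sh : ∀ t l → (3 + t) * l + (l + t * l) ≡ 2 * ((2 + t) * l)
      sh = solve-∀
      step : ∀ j → 2 * classes (E j) (fresh j) ≤ l + single colour 2 j
      step j with colour ≟ j
      ... | yes refl = fresh-colour
      ... | no i≢j = ≤-trans (fresh-paired (≢-sym i≢j)) (m≤m+n l 0)

    newClasses-< : 1 ≤ length new → newClasses < p * length new
    newClasses-< 1≤ = by-length new refl
      where
      by-length : ∀ A → new ≡ A → newClasses < p * length new
      by-length [] eq with () ← subst (1 ≤_) (cong length eq) 1≤
      by-length (_ ∷ []) eq = ≤-trans (s≤s (bound₁ (cong length eq)))
        (subst (λ l → 2 ≤ p * l) (sym (cong length eq)) (m≤m+n 2 (t * 1)))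
      by-length (_ ∷ _ ∷ []) eq = ≤-trans (s≤s (bound₂ eq))
        (subst (λ l → 4 ≤ p * l) (sym (cong length eq)) (m≤m+n 4 (t * 2)))
      by-length (_ ∷ _ ∷ _ ∷ _) eq = bound₃ (subst (3 ≤_) (sym (cong length eq)) (s≤s (s≤s (s≤s z≤n))))

    extend-total : 1 ≤ length new → totalClasses (new ++ U) + 1 ≤ totalClasses U + p * length new
    extend-total 1≤ = begin
      totalClasses (new ++ U) + 1          ≤⟨ +-monoˡ-≤ 1 total-extend ⟩
      newClasses + totalClasses U + 1      ≡⟨ sh newClasses (totalClasses U) ⟩
      totalClasses U + suc newClasses      ≤⟨ +-monoʳ-≤ (totalClasses U) (newClasses-< 1≤) ⟩
      totalClasses U + p * length new      ∎
      where
      open ≤-Reasoning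
      sh : ∀ a b → a + b + 1 ≡ b + suc a
      sh = solve-∀

  -- Every addition to U uses up one unit of the order, so only 2δ of them are possible.
  almostPaired-bounded : Fin n → ∀ {Xs} → All AlmostPaired Xs →
    ∃ λ U → length U ≤ δ + (2 * δ) * (2 * δ) × (∀ {X} → X ∈ Xs → ∀ {a} → a ∈ X → a ∈ U)
  almostPaired-bounded u {Xs} aps with doublePairs-hitting-set u
  ... | Γ , uΓ , lΓ , hits with greedy aps
    where
    -- `s` counts the sets that brought something new. Each raises `p * length U - totalClasses U`
    -- by at least one and lengthens `U` by at most `2 * δ`. Starting from `Γ` costs `length Γ`,
    -- since `totalClasses Γ ≤ (1 + p) * length Γ`.
    Greedy : List (List (Fin n)) → Set
    Greedy Xs = ∃₂ λ U s → Unique U × (∀ {a} → a ∈ Γ → a ∈ U) ×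
      totalClasses U + s ≤ p * length U + length Γ ×
      length U ≤ length Γ + s * (2 * δ) ×
      (∀ {X} → X ∈ Xs → ∀ {a} → a ∈ X → a ∈ U)

    greedy : ∀ {Xs} → All AlmostPaired Xs → Greedy Xs
    greedy [] = Γ , 0 , uΓ , id
      , ≤-trans (≤-reflexive (+-identityʳ _)) (≤-trans (totalClasses-≤ Γ) (≤-reflexive (+-comm (length Γ) _)))
      , m≤m+n _ 0 , λ ()
    greedy {X ∷ Xs} (ap ∷ aps) with greedy aps
    ... | U , s , uU , Γ⊆U , cl , le , sub = by-new new refl
      where
      open Extend hits Γ⊆U ap
      sub′ : ∀ {a} → a ∈ X → a ∈ (new ++ U)
      sub′ {a} a∈ with a ∈? U
      ... | yes a∈U = ∈-++⁺ʳ new a∈U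
      ... | no a∉U = ∈-++⁺ˡ (∈-filter⁺ ∉U? a∈ a∉U)
      by-new : ∀ A → new ≡ A → Greedy (X ∷ Xs)
      by-new [] eq = U , s , uU , Γ⊆U , cl , le
        , λ { (here refl) a∈ → subst (λ A → _ ∈ (A ++ U)) eq (sub′ a∈) ; (there X∈) → sub X∈ }
      by-new (_ ∷ _) eq =
          new ++ U , suc s
        , Unique.++⁺ (Unique.filter⁺ ∉U? (AlmostPaired.unique ap)) uU (λ { (a∈ , a∈U) → new∉U a∈ a∈U })
        , ∈-++⁺ʳ new ∘ Γ⊆U
        , cl′ , le′
        , λ { (here refl) → sub′ ; (there X∈) → ∈-++⁺ʳ new ∘ sub X∈ }
        where
        open ≤-Reasoning
        1≤ : 1 ≤ length new
        1≤ = subst (1 ≤_) (sym (cong length eq)) (s≤s z≤n)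
        sh₁ : ∀ a b → a + suc b ≡ a + 1 + b
        sh₁ = solve-∀
        sh₂ : ∀ a b c → (a + b) + c ≡ (a + c) + b
        sh₂ = solve-∀
        sh₃ : ∀ p a b c → (p * a + b) + p * c ≡ p * (c + a) + b
        sh₃ = solve-∀
        cl′ : totalClasses (new ++ U) + suc s ≤ p * length (new ++ U) + length Γ
        cl′ = begin
          totalClasses (new ++ U) + suc s             ≡⟨ sh₁ (totalClasses (new ++ U)) s ⟩
          totalClasses (new ++ U) + 1 + s             ≤⟨ +-monoˡ-≤ s (extend-total 1≤) ⟩
          totalClasses U + p * length new + s         ≡⟨ sh₂ (totalClasses U) (p * length new) s ⟩
          totalClasses U + s + p * length new         ≤⟨ +-monoˡ-≤ (p * length new) cl ⟩
          p * length U + length Γ + p * length new    ≡⟨ sh₃ p (length U) (length Γ) (length new) ⟩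
          p * (length new + length U) + length Γ      ≡⟨ cong (λ l → p * l + length Γ) (sym (length-++ new)) ⟩
          p * length (new ++ U) + length Γ            ∎
        sh₄ : ∀ a b c → a + (b + c) ≡ b + (a + c)
        sh₄ = solve-∀
        le′ : length (new ++ U) ≤ length Γ + suc s * (2 * δ)
        le′ = begin
          length (new ++ U)                           ≡⟨ length-++ new ⟩
          length new + length U
            ≤⟨ +-mono-≤ (≤-trans (length-filter ∉U? X) (almostPaired-length ap)) le ⟩
          2 * δ + (length Γ + s * (2 * δ))            ≡⟨ sh₄ (2 * δ) (length Γ) (s * (2 * δ)) ⟩
          length Γ + suc s * (2 * δ)                  ∎
  -- The empty `U` is treated apart because `subset-order` speaks of nonempty sets.
  ... | [] , _ , _ , _ , _ , _ , sub = [] , z≤n , sub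
  ... | U@(_ ∷ _) , s , uU , _ , cl , le , sub =
    U , ≤-trans le (+-mono-≤ lΓ (*-monoˡ-≤ (2 * δ) s≤)) , sub
    where
    open ≤-Reasoning
    sh₁ : ∀ a b → a + (b + 1) ≡ a + b + 1
    sh₁ = solve-∀
    sh₂ : ∀ a b c → a + b + c ≡ (a + c) + b
    sh₂ = solve-∀
    -- Comparing `cl` with `subset-order` gives `s + 1 ≤ length Γ + δ`.
    s≤ : s ≤ 2 * δ
    s≤ = ≤-trans (m≤m+n s 1) (+-cancelˡ-≤ (totalClasses U) _ _ (begin
      totalClasses U + (s + 1)               ≡⟨ sh₁ (totalClasses U) s ⟩
      totalClasses U + s + 1                 ≤⟨ +-monoˡ-≤ 1 cl ⟩
      p * length U + length Γ + 1            ≡⟨ sh₂ (p * length U) (length Γ) 1 ⟩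
      p * length U + 1 + length Γ            ≤⟨ +-mono-≤ (subset-order uU) lΓ ⟩
      totalClasses U + δ + δ                 ≡⟨ sh₃ (totalClasses U) δ ⟩
      totalClasses U + 2 * δ                 ∎))
      where
      sh₃ : ∀ a b → a + b + b ≡ a + 2 * b
      sh₃ = solve-∀

-- Cycles of permutations and transpositions

transpose-≡ˡ : (i j : Fin n) → transpose i j i ≡ j
transpose-≡ˡ i j with i ≟ i
... | yes _ = refl
... | no ¬p = contradiction refl ¬p

transpose-≡ʳ : (i j : Fin n) → transpose i j j ≡ i
transpose-≡ʳ i j with j ≟ i
... | yes j≡i = j≡i
... | no _ with j ≟ j
...   | yes _ = refl
...   | no ¬p = contradiction refl ¬p

transpose-≢ : (i j : Fin n) {k : Fin n} → k ≢ i → k ≢ j → transpose i j k ≡ k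
transpose-≢ i j {k} k≢i k≢j with k ≟ i
... | yes k≡i = contradiction k≡i k≢i
... | no _ with k ≟ j
...   | yes k≡j = contradiction k≡j k≢j
...   | no _ = refl

transpose-involutive : (i j k : Fin n) → transpose i j (transpose i j k) ≡ k
transpose-involutive i j k = aux (k ≟ i) (k ≟ j)
  where
  aux : Dec (k ≡ i) → Dec (k ≡ j) → transpose i j (transpose i j k) ≡ k
  aux (yes refl) _ = trans (cong (transpose i j) (transpose-≡ˡ i j)) (transpose-≡ʳ i j)
  aux (no _) (yes refl) = trans (cong (transpose i j) (transpose-≡ʳ i j)) (transpose-≡ˡ i j)
  aux (no k≢i) (no k≢j) = trans (cong (transpose i j) (transpose-≢ i j k≢i k≢j)) (transpose-≢ i j k≢i k≢j)

transpose-cancel : (w z x y b : Fin n) → transpose x y (transpose w z (transpose w z (transpose x y b))) ≡ b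
transpose-cancel w z x y b =
  trans (cong (transpose x y) (transpose-involutive w z (transpose x y b))) (transpose-involutive x y b)

transpose-injective : (i j : Fin n) → Injective _≡_ _≡_ (transpose i j)
transpose-injective i j {k} {l} eq =
  trans (sym (transpose-involutive i j k)) (trans (cong (transpose i j) eq) (transpose-involutive i j l))

-- `Q` arises from `P` by merging the class of `a` with that of `b`.
record Joins (P Q : Partition n) (a b : Fin n) : Set where
  Near : Fin n → Set
  Near c = _~_ P c a ⊎ _~_ P c b
  field
    apart   : ¬ _~_ P a b
    include : ∀ {c d} → _~_ P c d → _~_ Q c d
    join    : _~_ Q a b
    split   : ∀ {c d} → _~_ Q c d → _~_ P c d ⊎ (Near c × Near d)

joins-sym : {P Q : Partition n} {a b : Fin n} → Joins P Q a b → Joins P Q b a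
joins-sym {P = P} {Q} J = record
  { apart = apart ∘ ~-sym P ; include = include ; join = ~-sym Q join
  ; split = Sum.map₂ (Product.map swap swap) ∘ split }
  where open Joins J

-- Representatives for `Q` stay independent in `P`. The one of the merged class is related in `P` to
-- one of `a` and `b`; adding the other completes a transversal of `P`.
joins-classes : {P Q : Partition n} {a b : Fin n} → Joins P Q a b →
                classes P (allFin n) ≡ suc (classes Q (allFin n))
joins-classes {n} {P} {Q} {a} {b} J = result
  where
  R = reps Q (allFin n)
  cov : ∀ c → Meets Q c R
  cov c = reps-cover Q (allFin n) (∈-allFin c)
  uniqueRep : ∀ {r r′} → r ∈ R → r′ ∈ R → _~_ Q r r′ → r ≡ r′
  uniqueRep = allPairs-unique (~-sym Q) (reps-indep Q (allFin n))

  add : ∀ {a b} → Joins P Q a b → ∀ {r} → r ∈ R → _~_ P r a → classes P (allFin n) ≡ suc (length R)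
  add {a} {b} J {r} r∈ r~a = classes-transversal P {ts = b ∷ R}
    (All.tabulate (λ {s} s∈ b~s → apart (~-trans P (~-sym P r~a)
        (subst (λ z → _~_ P z b) (uniqueRep s∈ r∈ (~-trans Q (~-sym Q (include b~s))
            (~-trans Q (~-sym Q join) (~-sym Q (include r~a))))) (~-sym P b~s))))
      ∷ AllPairs.map (λ ¬Q → ¬Q ∘ include) (reps-indep Q (allFin n)))
    (λ {c} _ → meets-∈ P (∈-allFin c))
    (λ {c} _ → cover c (find (cov c)))
    where
    open Joins J
    cover : ∀ c → ∃ (λ s → s ∈ R × _~_ Q c s) → Meets P c (b ∷ R)
    cover c (s , s∈ , c~s) with split c~s
    ... | inj₁ p = there (lose s∈ p)
    ... | inj₂ (inj₂ c~b , _) = here c~b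
    ... | inj₂ (inj₁ c~a , near) =
      there (lose r∈ (~-trans P c~a (~-sym P r~a)))

  result : classes P (allFin n) ≡ suc (classes Q (allFin n))
  result with find (cov a)
  ... | r , r∈ , a~r with Joins.split J a~r
  ...   | inj₁ p = add J r∈ (~-sym P p)
  ...   | inj₂ (_ , inj₁ r~a) = add J r∈ r~a
  ...   | inj₂ (_ , inj₂ r~b) = add (joins-sym {P = P} {Q} J) r∈ r~b

module _ (f : Fin n → Fin n) where

  Orbit : Fin n → Fin n → Set
  Orbit a b = ∃ λ k → iter k f a ≡ b

  iter-+ : ∀ m k a → iter (m + k) f a ≡ iter m f (iter k f a)
  iter-+ zero k a = refl
  iter-+ (suc m) k a = cong f (iter-+ m k a)

  iter-* : ∀ m {p a} → iter p f a ≡ a → iter (m * p) f a ≡ a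
  iter-* zero _ = refl
  iter-* (suc m) {p} {a} eq = trans (iter-+ p (m * p) a) (trans (cong (iter p f) (iter-* m eq)) eq)

  iter-% : ∀ k {p a} → iter (suc p) f a ≡ a → iter k f a ≡ iter (k % suc p) f a
  iter-% k {p} {a} eq = trans (cong (λ m → iter m f a) (m≡m%n+[m/n]*n k (suc p)))
    (trans (iter-+ (k % suc p) _ a) (cong (iter (k % suc p) f) (iter-* (k / suc p) eq)))

  orbit-refl : ∀ {a} → Orbit a a
  orbit-refl = 0 , refl

  orbit-trans : ∀ {a b c} → Orbit a b → Orbit b c → Orbit a c
  orbit-trans (k , refl) (m , refl) = m + k , iter-+ m k _

  orbit-induction : (Q : Fin n → Set) → (∀ {b} → Q b → Q (f b)) → ∀ {a b} → Orbit a b → Q a → Q b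
  orbit-induction Q step (k , refl) Qa = go k
    where
    go : ∀ k → Q (iter k f _)
    go zero = Qa
    go (suc k) = step (go k)

  module _ (inj : Injective _≡_ _≡_ f) where

    iter-injective : ∀ k {a b} → iter k f a ≡ iter k f b → a ≡ b
    iter-injective zero eq = eq
    iter-injective (suc k) eq = iter-injective k (inj eq)

    -- Among `n + 1` iterates two coincide, and injectivity cancels their common initial steps.
    period : ∀ a → ∃ λ p → suc p ≤ n × iter (suc p) f a ≡ a
    period a with pigeonhole (n<1+n n) (λ i → iter (toℕ i) f a)
    ... | i , j , i<j , eq = p , ≤-trans (subst (_≤ toℕ j) (+-comm (suc p) 0)
        (subst (suc p + 0 ≤_) sj (+-monoʳ-≤ (suc p) z≤n))) (≤-pred (toℕ<n j))
        , iter-injective (toℕ i) (trans (sym (iter-+ (toℕ i) (suc p) a))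
            (trans (cong (λ m → iter m f a) (trans (+-comm (toℕ i) (suc p)) sj)) (sym eq)))
      where
      p = toℕ j ∸ suc (toℕ i)
      sj : suc p + toℕ i ≡ toℕ j
      sj = trans (sym (+-suc p (toℕ i))) (m∸n+n≡m i<j)

    orbit-bounded : ∀ {a b} → Orbit a b → ∃ λ (i : Fin n) → iter (toℕ i) f a ≡ b
    orbit-bounded {a} (k , eq) with period a
    ... | p , p<n , per = fromℕ< lt , trans (cong (λ m → iter m f a) (toℕ-fromℕ< lt))
        (trans (sym (iter-% k per)) eq)
      where lt = ≤-trans (m%n<n k (suc p)) p<n

    -- After `k` steps, `k * p` more complete `k` full periods of length `suc p`, so forward
    -- iteration leads back to `a`.
    orbit-sym : ∀ {a b} → Orbit a b → Orbit b a
    orbit-sym {a} (k , refl) with period a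
    ... | p , _ , per = k * p , trans (sym (iter-+ (k * p) k a))
            (trans (cong (λ m → iter m f a) (trans (+-comm (k * p) k) (sym (*-suc k p)))) (iter-* k per))

    orbit? : ∀ a b → Dec (Orbit a b)
    orbit? a b = map′ (λ (i , eq) → toℕ i , eq) orbit-bounded (any? λ i → iter (toℕ i) f a ≟ b)

    orbits : Partition n
    orbits = record
      { _~_ = Orbit
      ; isDecEquivalence = record
        { isEquivalence = record { refl = orbit-refl ; sym = orbit-sym ; trans = orbit-trans }
        ; _≟_ = orbit? } }

allPairs⁺ : {A : Set} {P : A → Set} {R : A → A → Set} → (∀ {a b} → P a → P b → a ≢ b → R a b) →
            ∀ {xs} → All P xs → Unique xs → AllPairs R xs
allPairs⁺ h [] [] = []
allPairs⁺ h (px ∷ pxs) (ux ∷ uxs) = All.zipWith (λ (py , x≢y) → h px py x≢y) (pxs , ux) ∷ allPairs⁺ h pxs uxs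

-- Each orbit has exactly one point of least label, so the points counted by `cycleCount` form a
-- transversal. By `orbit-bounded` the first `n` iterates exhaust the orbit.
cycleCount≡classes : (f : Fin n → Fin n) (inj : Injective _≡_ _≡_ f) →
                     cycleCount n f ≡ classes (orbits f inj) (allFin n)
cycleCount≡classes {n} f inj = sym (classes-transversal (orbits f inj) {allFin n} {filterᵇ minᵇ (allFin n)}
  (allPairs⁺ {P = T ∘ minᵇ} (λ ma mb a≢b a~b → a≢b (toℕ-injective
      (≤-antisym (minimal ma a~b) (minimal mb (orbit-sym f inj a~b)))))
     (All.all-filter (T? ∘ minᵇ) (allFin n)) (Unique.filter⁺ (T? ∘ minᵇ) (Unique.allFin⁺ n)))
  (λ {a} _ → meets-∈ (orbits f inj) (∈-allFin a))
  (λ {a} _ → let b , a~b , mb = least (suc (toℕ a)) ≤-refl in lose (∈-filter⁺ (T? ∘ minᵇ) (∈-allFin b) mb) a~b))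
  where
  minᵇ : Fin n → Bool
  minᵇ b = all (λ k → toℕ b ≤ᵇ toℕ (iter k f b)) (upTo n)
  minimal : ∀ {a b} → T (minᵇ a) → Orbit f a b → toℕ a ≤ toℕ b
  minimal {a} {b} m a~b with orbit-bounded f inj a~b
  ... | i , refl = ≤ᵇ⇒≤ _ _ (All.lookup (All.all⁺ _ (upTo n) m) (∈-upTo⁺ (toℕ<n i)))
  least : ∀ m {a} → toℕ a < m → ∃ λ b → Orbit f a b × T (minᵇ b)
  least (suc m) {a} a<m with any? (λ (i : Fin n) → toℕ (iter (toℕ i) f a) <? toℕ a)
  ... | yes (i , lt) = let b , o , mb = least m (≤-trans lt (≤-pred a<m)) in b , orbit-trans f (toℕ i , refl) o , mb
  ... | no ¬lt = a , orbit-refl f , All.all⁻ _ {upTo n} (All.tabulate λ {k} k∈ →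
        ≤⇒≤ᵇ (subst (λ m → toℕ a ≤ toℕ (iter m f a)) (toℕ-fromℕ< (∈-upTo⁻ k∈))
            (≮⇒≥ λ lt → ¬lt (fromℕ< (∈-upTo⁻ k∈) , lt))))

orbit-cong : {f h : Fin n → Fin n} → (∀ a → f a ≡ h a) → ∀ {a b} → Orbit f a b → Orbit h a b
orbit-cong {f = f} {h} eq {a} (k , refl) = k , go k
  where
  go : ∀ k → iter k h a ≡ iter k f a
  go zero = refl
  go (suc k) = trans (cong h (go k)) (sym (eq _))

module _ {f h : Fin n → Fin n} (f-inj : Injective _≡_ _≡_ f) (h-inj : Injective _≡_ _≡_ h)
         {a b : Fin n} (h≗ : ∀ c → h c ≡ transpose a b (f c)) where

  private
    h-a : ∀ {c} → f c ≡ a → h c ≡ b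
    h-a eq = trans (h≗ _) (trans (cong (transpose a b) eq) (transpose-≡ˡ a b))
    h-b : ∀ {c} → f c ≡ b → h c ≡ a
    h-b eq = trans (h≗ _) (trans (cong (transpose a b) eq) (transpose-≡ʳ a b))
    h-else : ∀ {c} → f c ≢ a → f c ≢ b → h c ≡ f c
    h-else ≢a ≢b = trans (h≗ _) (transpose-≢ a b ≢a ≢b)

  -- `h` differs from `f` only in exchanging the images of the two points sent to `a` and `b`. When
  -- these lie on different cycles, the two cycles are spliced and all others stay.
  transpose-joins : ¬ Orbit f a b → Joins (orbits f f-inj) (orbits h h-inj) a b
  transpose-joins apart = record { apart = apart ; include = include ; join = join ; split = split }
    where
    Near : Fin n → Set
    Near c = Orbit f c a ⊎ Orbit f c b

    near-step : ∀ {c d} → Orbit f c d → Near c → Near d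
    near-step o (inj₁ x) = inj₁ (orbit-trans f (orbit-sym f f-inj o) x)
    near-step o (inj₂ x) = inj₂ (orbit-trans f (orbit-sym f f-inj o) x)

    split : ∀ {c d} → Orbit h c d → Orbit f c d ⊎ (Near c × Near d)
    split {c} o = orbit-induction h (λ d → Orbit f c d ⊎ (Near c × Near d)) step o (inj₁ (orbit-refl f))
      where
      step : ∀ {d} → Orbit f c d ⊎ (Near c × Near d) → Orbit f c (h d) ⊎ (Near c × Near (h d))
      step {d} s with f d ≟ a | f d ≟ b
      step {d} (inj₁ o) | yes eq | _ = inj₂ (inj₁ (orbit-trans f o (1 , eq)) , inj₂ (0 , h-a eq))
      step {d} (inj₂ (nc , _)) | yes eq | _ = inj₂ (nc , inj₂ (0 , h-a eq))
      step {d} (inj₁ o) | no _ | yes eq = inj₂ (inj₂ (orbit-trans f o (1 , eq)) , inj₁ (0 , h-b eq))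
      step {d} (inj₂ (nc , _)) | no _ | yes eq = inj₂ (nc , inj₁ (0 , h-b eq))
      step {d} (inj₁ o) | no ≢a | no ≢b = inj₁ (orbit-trans f o (1 , sym (h-else ≢a ≢b)))
      step {d} (inj₂ (nc , nd)) | no ≢a | no ≢b = inj₂ (nc , near-step (1 , sym (h-else ≢a ≢b)) nd)

    -- Follow f from a: the step that would return to a is diverted to b.
    join : Orbit h a b
    join with period f f-inj a
    ... | p , _ , per with reach p
      where
      reach : ∀ k → Orbit h a (iter k f a) ⊎ Orbit h a b
      reach zero = inj₁ (orbit-refl h)
      reach (suc k) with reach k
      ... | inj₂ o = inj₂ o
      ... | inj₁ o with f (iter k f a) ≟ a
      ...   | yes eq = inj₂ (orbit-trans h o (1 , h-a eq))
      ...   | no ≢a = inj₁ (orbit-trans h o (1 , h-else ≢a (λ eq → apart (suc k , eq))))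
    ...   | inj₁ o = orbit-trans h o (1 , h-a per)
    ...   | inj₂ o = o

    include : ∀ {c d} → Orbit f c d → Orbit h c d
    include {c} o = orbit-induction f (Orbit h c) step o (orbit-refl h)
      where
      step : ∀ {d} → Orbit h c d → Orbit h c (f d)
      step {d} o with f d ≟ a | f d ≟ b
      ... | yes eq | _ = orbit-trans h o (orbit-trans h (1 , h-a eq)
          (subst (Orbit h b) (sym eq) (orbit-sym h h-inj join)))
      ... | no _ | yes eq = orbit-trans h o (orbit-trans h (1 , h-b eq) (subst (Orbit h a) (sym eq) join))
      ... | no ≢a | no ≢b = orbit-trans h o (1 , h-else ≢a ≢b)

  -- Take the first return from `a` to `a` or `b` under `f`. A return to `a` would leave `b` off the
  -- cycle. Otherwise `h` closes the stretch from `a` to just before `b` into a cycle that omits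
  -- `b`.
  transpose-apart : a ≢ b → Orbit f a b → ¬ Orbit h a b
  transpose-apart a≢b a~b h-ab = conclude (first a~b)
    where
    Hit : ℕ → Set
    Hit j = iter (suc j) f a ≡ a ⊎ iter (suc j) f a ≡ b
    hit? : ∀ j → Dec (Hit j)
    hit? j = (iter (suc j) f a ≟ a) ⊎-dec (iter (suc j) f a ≟ b)

    first : Orbit f a b → ∃ λ m → Hit m × (∀ j → j < m → ¬ Hit j)
    first (zero , eq) = contradiction eq a≢b
    first (suc k , eq) = go k 0 (λ _ ()) (inj₂ (subst (λ m → iter (suc m) f a ≡ b) (sym (+-identityʳ k)) eq))
      where
      go : ∀ k m → (∀ j → j < m → ¬ Hit j) → Hit (k + m) → ∃ λ m → Hit m × (∀ j → j < m → ¬ Hit j)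
      go zero m before hit = m , hit , before
      go (suc k) m before hit with hit? m
      ... | yes h = m , h , before
      ... | no ¬h = go k (suc m) before′ (subst Hit (sym (+-suc k m)) hit)
        where
        before′ : ∀ j → j < suc m → ¬ Hit j
        before′ j j< with m≤n⇒m<n∨m≡n (≤-pred j<)
        ... | inj₁ j<m = before j j<m
        ... | inj₂ refl = ¬h

    conclude : ∃ (λ m → Hit m × (∀ j → j < m → ¬ Hit j)) → ⊥
    conclude (m , hit , before) = case hit
      where
      not-b : ∀ j → j ≤ m → iter j f a ≢ b
      not-b zero _ eq = a≢b eq
      not-b (suc j) j<m eq = before j j<m (inj₂ eq)
      case : Hit m → ⊥
      case (inj₁ per) = let k , eq = a~b in not-b (k % suc m) (≤-pred (m%n<n k (suc m))) (trans (sym (iter-% f k per)) eq)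
      case (inj₂ at-b) with orbit-induction h (λ w → ∃ λ j → j ≤ m × iter j f a ≡ w) step h-ab (0 , z≤n , refl)
        where
        step : ∀ {w} → ∃ (λ j → j ≤ m × iter j f a ≡ w) → ∃ λ j → j ≤ m × iter j f a ≡ h w
        step (j , j≤m , refl) with m≤n⇒m<n∨m≡n j≤m
        ... | inj₁ j<m = suc j , j<m , sym (h-else (λ eq → before j j<m (inj₁ eq))
            (λ eq → before j j<m (inj₂ eq)))
        ... | inj₂ refl = 0 , z≤n , sym (h-b at-b)
      ... | j , j≤m , eq = not-b j j≤m eq

-- Coloured graphs as families of permutations

==⇒≡ : {i j : Fin n} → T (i == j) → i ≡ j
==⇒≡ = toℕ-injective ∘ ≡ᵇ⇒≡ _ _

≡⇒== : {i j : Fin n} → i ≡ j → T (i == j)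
≡⇒== {i = i} refl = ≡⇒≡ᵇ (toℕ i) (toℕ i) refl

surjective : {f : Fin n → Fin n} → Injective _≡_ _≡_ f → ∀ w → ∃ λ b → f b ≡ w
surjective {f = f} inj w = let p , _ , eq = period f inj w in iter p f w , eq

vec-ext : {A : Set} {u v : Vec A n} → (∀ i → lookup u i ≡ lookup v i) → u ≡ v
vec-ext {u = []} {[]} _ = refl
vec-ext {u = _ ∷ _} {_ ∷ _} eq = cong₂ _∷_ (eq zero) (vec-ext (eq ∘ suc))

concatMap≡cartesianProductWith : {A B C : Set} (f : A → B → C) (xs : List A) (ys : List B) →
  concatMap (λ x → map (f x) ys) xs ≡ cartesianProductWith f xs ys
concatMap≡cartesianProductWith f [] ys = refl
concatMap≡cartesianProductWith f (x ∷ xs) ys = cong (map (f x) ys ++_) (concatMap≡cartesianProductWith f xs ys)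

allVecs≡ : {A : Set} (xs : List A) (n : ℕ) → allVecs xs (suc n) ≡ cartesianProductWith _∷_ xs (allVecs xs n)
allVecs≡ xs n = concatMap≡cartesianProductWith _∷_ xs (allVecs xs n)

∈-allVecs⁺ : {A : Set} {xs : List A} {v : Vec A n} → (∀ i → lookup v i ∈ xs) → v ∈ allVecs xs n
∈-allVecs⁺ {v = []} _ = here refl
∈-allVecs⁺ {n = suc n} {xs = xs} {v = x ∷ v} h = subst (x ∷ v ∈_) (sym (allVecs≡ xs n))
  (∈-cartesianProductWith⁺ _∷_ (h zero) (∈-allVecs⁺ (h ∘ suc)))

∈-allVecs⁻ : {A : Set} {xs : List A} {v : Vec A n} → v ∈ allVecs xs n → ∀ i → lookup v i ∈ xs
∈-allVecs⁻ {n = suc n} {xs = xs} {v = x ∷ v} v∈ i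
  with ∈-cartesianProductWith⁻ _∷_ xs (allVecs xs n) (subst (x ∷ v ∈_) (allVecs≡ xs n) v∈)
∈-allVecs⁻ {n = suc n} v∈ zero | _ , _ , x∈ , _ , refl = x∈
∈-allVecs⁻ {n = suc n} v∈ (suc i) | _ , _ , _ , v∈′ , refl = ∈-allVecs⁻ v∈′ i

allVecs-unique : {A : Set} {xs : List A} → Unique xs → ∀ n → Unique (allVecs xs n)
allVecs-unique u zero = [] ∷ []
allVecs-unique {xs = xs} u (suc n) = subst Unique (sym (allVecs≡ xs n))
  (Unique.cartesianProductWith⁺ _∷_ ∷-injective u (allVecs-unique u n))

∈-Perms⁺ : {v : Vec (Fin n) n} → Injective _≡_ _≡_ (lookup v) → v ∈ Perms n
∈-Perms⁺ {n} {v} inj = ∈-filter⁺ (T? ∘ injectiveᵇ) (∈-allVecs⁺ {v = v} (λ i → ∈-allFin _))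
  (All.all⁻ _ (All.tabulate {xs = allFin n} λ {i} _ → All.all⁻ _
      (All.tabulate {xs = allFin n} λ {j} _ → test i j)))
  where
  test : ∀ i j → T (not (lookup v i == lookup v j) ∨ (i == j))
  test i j with lookup v i == lookup v j in eq
  ... | false = _
  ... | true = ≡⇒== (inj (==⇒≡ (from Bool.T-≡ eq)))

∈-Perms⁻ : {v : Vec (Fin n) n} → v ∈ Perms n → Injective _≡_ _≡_ (lookup v)
∈-Perms⁻ {n} {v} v∈ {i} {j} eq with to (T-∨ {not (lookup v i == lookup v j)})
    (All.lookup (All.all⁺ _ (allFin n) (All.lookup (All.all⁺ _ (allFin n)
        (proj₂ (∈-filter⁻ (T? ∘ injectiveᵇ) {xs = allVecs (allFin n) n} v∈))) (∈-allFin i))) (∈-allFin j))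
... | inj₂ t = ==⇒≡ t
... | inj₁ t = contradiction (≡⇒== {i = lookup v i} eq) (λ t′ → not-both t t′)
  where
  not-both : ∀ {b} → T (not b) → T b → ⊥
  not-both {true} ()

Perms-unique : ∀ n → Unique (Perms n)
Perms-unique n = Unique.filter⁺ (T? ∘ injectiveᵇ) (allVecs-unique (Unique.allFin⁺ n) n)

π : Colouring n q → Fin (suc q) → Fin n → Fin n
π ps c = lookup (lookup ps c)

Valid : Colouring n q → Set
Valid ps = ∀ c → Injective _≡_ _≡_ (π ps c)

∈-allRGraphs⁺ : {r : Fin n} {ps : Colouring n q} → Valid ps → (r , ps) ∈ allRGraphs n q
∈-allRGraphs⁺ {n} {q} {r} {ps} v = subst ((r , ps) ∈_) (sym (concatMap≡cartesianProductWith _,_ (allFin n) _))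
  (∈-cartesianProductWith⁺ _,_ (∈-allFin r) (∈-allVecs⁺ (λ c → ∈-Perms⁺ (v c))))

∈-allRGraphs⁻ : {r : Fin n} {ps : Colouring n q} → (r , ps) ∈ allRGraphs n q → Valid ps
∈-allRGraphs⁻ {n} {q} {r} {ps} G∈ c
  with ∈-cartesianProductWith⁻ _,_ (allFin n) (allVecs (Perms n) (suc q))
      (subst ((r , ps) ∈_) (concatMap≡cartesianProductWith _,_ (allFin n) _) G∈)
... | _ , _ , _ , ps∈ , refl = ∈-Perms⁻ (∈-allVecs⁻ ps∈ c)

allRGraphs-unique : ∀ n q → Unique (allRGraphs n q)
allRGraphs-unique n q = subst Unique (sym (concatMap≡cartesianProductWith _,_ (allFin n) _))
  (Unique.cartesianProductWith⁺ _,_ (λ { refl → refl , refl }) (Unique.allFin⁺ n)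
      (allVecs-unique (Perms-unique n) (suc q)))

-- Solving `search = _` against a with-abstracted list gives a name to the local function of `invAt`.
mutual
  search : Vec (Fin n) n → Fin n → Fin n → List (Fin n) → Fin n
  search = _

  invAt≡search : (v : Vec (Fin n) n) (w d : Fin n) → invAt v w d ≡ search v w d (allFin n)
  invAt≡search {n} v w d with allFin n
  ... | bs = refl

search-spec : (v : Vec (Fin n) n) (w d : Fin n) {b : Fin n} {bs : List (Fin n)} →
              b ∈ bs → lookup v b ≡ w → lookup v (search v w d bs) ≡ w
search-spec v w d {b} {b′ ∷ bs} b∈ eq with lookup v b′ == w in t
search-spec v w d {b} {b′ ∷ bs} b∈ eq | true = ==⇒≡ (from Bool.T-≡ t)
search-spec v w d {b} {b′ ∷ bs} (here refl) eq | false = contradiction (≡⇒== eq) (λ t′ → subst T t t′)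
search-spec v w d {b} {b′ ∷ bs} (there b∈) eq | false = search-spec v w d b∈ eq

invAt-spec : {v : Vec (Fin n) n} → Injective _≡_ _≡_ (lookup v) → ∀ w d → lookup v (invAt v w d) ≡ w
invAt-spec {v = v} inj w d = let b , eq = surjective inj w in
  trans (cong (lookup v) (invAt≡search v w d)) (search-spec v w d (∈-allFin b) eq)

σ : Colouring n q → Fin (suc q) → Fin n → Fin n
σ ps c b = invAt (lookup ps c) (lookup (lookup ps zero) b) b

module _ (ps : Colouring n q) (valid : Valid ps) where

  σ-spec : ∀ c b → π ps c (σ ps c b) ≡ π ps zero b
  σ-spec c b = invAt-spec {v = lookup ps c} (valid c) _ b

  σ-unique : ∀ {c b b′} → π ps c b′ ≡ π ps zero b → σ ps c b ≡ b′
  σ-unique {c} {b} eq = valid c (trans (σ-spec c b) (sym eq))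

  σ-injective : ∀ c → Injective _≡_ _≡_ (σ ps c)
  σ-injective c {a} {b} eq = valid zero (trans (sym (σ-spec c a)) (trans (cong (π ps c) eq) (σ-spec c b)))

  faces : Fin q → Partition n
  faces j = orbits (σ ps (suc j)) (σ-injective (suc j))

  open Family faces

  F₀≡totalClasses : ∀ r → F₀ (r , ps) ≡ totalClasses (allFin n)
  F₀≡totalClasses r = trans (cong listSum (trans (sym (map-∘ (allFin q)))
      (map-tabulate id (bicycles ps ∘ suc)))) (go λ j → cycleCount≡classes (σ ps (suc j)) (σ-injective (suc j)))
    where
    go : ∀ {q} {f h : Fin q → ℕ} → (∀ j → f j ≡ h j) → listSum (tabulate f) ≡ sum h
    go {zero} _ = refl
    go {suc q} eq = cong₂ _+_ (eq zero) (go (eq ∘ suc))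

Closed : Colouring n q → List (Fin (suc q)) → (Fin n → Set) → Set
Closed ps C P = ∀ {c d b b′} → c ∈ C → d ∈ C → π ps c b ≡ π ps d b′ → P b → P b′

module _ {ps : Colouring n q} {C : List (Fin (suc q))} {r : Fin n} where

  private
    R : ℕ → Fin n → Bool
    R = reachᵇ ps C r

    step⁻ : ∀ k {b} → T (R (suc k) b) →
            T (R k b) ⊎ ∃ λ b′ → T (R k b′) × ∃₂ λ c d → c ∈ C × d ∈ C × π ps c b′ ≡ π ps d b
    step⁻ k t with to T-∨ t
    ... | inj₁ s = inj₁ s
    ... | inj₂ s with find (Any.any⁻ _ (allFin n) s)
    ...   | b′ , _ , u with to T-∧ u
    ...     | rb′ , v with find (Any.any⁻ _ C v)
    ...       | c , c∈ , w with find (Any.any⁻ _ C w)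
    ...         | d , d∈ , e = inj₂ (b′ , rb′ , c , d , c∈ , d∈ , ==⇒≡ e)

    step⁺ : ∀ k {b b′ c d} → T (R k b′) → c ∈ C → d ∈ C → π ps c b′ ≡ π ps d b → T (R (suc k) b)
    step⁺ k {b} {b′} t c∈ d∈ eq = from (T-∨ {R k b}) (inj₂ (Any.any⁺ _ (lose (∈-allFin b′)
      (from T-∧ (t , Any.any⁺ _ (lose c∈ (Any.any⁺ _ (lose d∈ (≡⇒== eq)))))))))

    step-mono : ∀ k {b} → T (R k b) → T (R (suc k) b)
    step-mono k {b} t = from (T-∨ {R k b}) (inj₁ t)

  connected-elim : T (connectedWithᵇ C (r , ps)) → (P : Fin n → Set) → Closed ps C P → P r → ∀ b → P b
  connected-elim t P closed Pr b = go n (All.lookup (All.all⁺ _ (allFin n) t) (∈-allFin b))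
    where
    go : ∀ k {b} → T (R k b) → P b
    go zero t = subst P (==⇒≡ t) Pr
    go (suc k) t with step⁻ k t
    ... | inj₁ s = go k s
    ... | inj₂ (b′ , s , c , d , c∈ , d∈ , eq) = closed c∈ d∈ eq (go k s)

  -- The reachable sets cannot grow n times, so one of the first n of them is closed.
  disconnected : ¬ T (connectedWithᵇ C (r , ps)) →
    ∃ λ (A : Fin n → Bool) → T (A r) × Closed ps C (T ∘ A) × ∃ λ b → ¬ T (A b)
  disconnected ¬t with ¬∀⟶∃¬ n (λ b → T (R n b)) (λ b → T? (R n b))
      (λ h → ¬t (All.all⁻ _ (All.tabulate {xs = allFin n} (λ {b} _ → h b))))
  ... | b , ¬Rb with search-stable n
    where
    Stable : ℕ → Set
    Stable k = ∀ b → T (R (suc k) b) → T (R k b)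
    search-stable : ∀ m → (∃ λ k → k ≤ m × Stable k) ⊎ ∃ λ xs → Unique xs × length xs ≡ suc m ×
        (∀ {b} → b ∈ xs → T (R m b))
    search-stable zero = inj₂ (r ∷ [] , [] ∷ [] , refl , λ { (here refl) → ≡⇒== {i = r} refl })
    search-stable (suc m) with search-stable m
    ... | inj₁ (k , k≤m , st) = inj₁ (k , m≤n⇒m≤1+n k≤m , st)
    ... | inj₂ (xs , u , len , sub) with any? (λ b → T? (R (suc m) b) ×-dec ¬? (T? (R m b)))
    ...   | yes (b , t , ¬t′) = inj₂ (b ∷ xs , All.tabulate
        (λ {x} x∈ → λ { refl → ¬t′ (sub x∈) }) ∷ u , cong suc len
            , λ { (here refl) → t ; (there x∈) → step-mono m (sub x∈) })
    ...   | no none = inj₁ (m , n≤1+n m , λ b t → decidable-stable (T? (R m b)) (λ ¬t′ → none (b , t , ¬t′)))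
  ...   | inj₂ (xs , u , len , _) = contradiction (subst (_≤ n) len (unique-length-≤ u)) (<-irrefl refl)
  ...   | inj₁ (k , k≤n , st) = R k , at-root k , (λ c∈ d∈ eq t → st _ (step⁺ k t c∈ d∈ eq)) , b , ¬Rb ∘ up k≤n
    where
    at-root : ∀ k → T (R k r)
    at-root zero = ≡⇒== {i = r} refl
    at-root (suc k) = step-mono k (at-root k)
    up : ∀ {k m b} → k ≤ m → T (R k b) → T (R m b)
    up {k} {m} {b} k≤m t = subst (λ m → T (R m b)) (m∸n+n≡m k≤m) (go (m ∸ k))
      where
      go : ∀ d → T (R (d + k) b)
      go zero = t
      go (suc d) = step-mono (d + k) (go d)

module _ (ps : Colouring n q) (valid : Valid ps) (r : Fin n) where
  open Family (faces ps valid)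

  -- A step of `connectedᵇ` joins black vertices with a common white neighbour. Both are compared
  -- with `b₀`, whose colour-0 edge ends there, since `σ` sends `b₀` to each of them. Equivalences
  -- are carried along because the starting point `a` need not be the root.
  connected⇒ : T (connectedᵇ (r , ps)) → Connected
  connected⇒ t P closed {a} {b} Pa = proj₁ (toRoot b) (proj₂ (toRoot a) Pa)
    where
    _↔_ : Fin n → Fin n → Set
    a ↔ b = (P a → P b) × (P b → P a)
    near : ∀ c {b b₀} → π ps zero b₀ ≡ π ps c b → b₀ ↔ b
    near zero eq = subst P (valid zero eq) , subst P (sym (valid zero eq))
    near (suc j) {b} {b₀} eq = closed j b₀~b , closed j (~-sym (faces ps valid j) b₀~b)
      where b₀~b = 1 , σ-unique ps valid (sym eq)
    toRoot : ∀ b → r ↔ b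
    toRoot = connected-elim t (r ↔_) step (id , id)
      where
      step : Closed ps (allColours q) (r ↔_)
      step {c} {d} {b} {b′} _ _ eq (r⇒b , b⇒r) =
        let b₀ , eq₀ = surjective (valid zero) (π ps c b)
            (f , g) = near c {b} eq₀
            (f′ , g′) = near d {b′} (trans eq₀ eq)
        in f′ ∘ g ∘ r⇒b , b⇒r ∘ f ∘ g′

  connected⇐ : Connected → T (connectedᵇ (r , ps))
  connected⇐ conn = decidable-stable (T? _) λ ¬t →
    let A , Ar , closed , b , ¬Ab = disconnected ¬t
    in ¬Ab (conn (T ∘ A) (λ j o Aa → orbit-induction (σ ps (suc j)) (T ∘ A)
         (λ {b} → closed (∈-allFin zero) (∈-allFin (suc j)) (sym (σ-spec ps valid (suc j) b))) o Aa) Ar)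

-- Cut sets of graphs that are not SYK, and the rotation of a cycle

T-ext : ∀ {x y} → (T x → T y) → (T y → T x) → x ≡ y
T-ext {false} {false} _ _ = refl
T-ext {false} {true} _ h = ⊥-elim (h _)
T-ext {true} {false} h _ = ⊥-elim (h _)
T-ext {true} {true} _ _ = refl

-- A Boolean function takes the same value before and after a full turn of a cycle, so it
-- cannot change exactly once.
another-change : {f : Fin n → Fin n} → Injective _≡_ _≡_ f → (A : Fin n → Bool) →
  ∀ {a} → A a ≢ A (f a) → ∃ λ b → b ≢ a × Orbit f a b × A b ≢ A (f b)
another-change {f = f} inj A {a} Aa≢ with period f inj a
... | p , _ , per = let b , o , Ab≡ , Afb≢ = go p (f a) (trans (shift p a) per) refl in
    b , (λ b≡a → Aa≢ (trans (cong A (sym b≡a)) Ab≡)) , orbit-trans f (1 , refl) o , λ eq → Afb≢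
        (trans (sym eq) Ab≡)
  where
  shift : ∀ k a → iter k f (f a) ≡ f (iter k f a)
  shift zero a = refl
  shift (suc k) a = cong f (shift k a)
  go : ∀ m b → iter m f b ≡ a → A b ≡ A (f a) → ∃ λ b′ → Orbit f b b′ × A b′ ≡ A (f a) × A (f b′) ≢ A (f a)
  go zero b refl Ab≡ = contradiction Ab≡ Aa≢
  go (suc m) b eq Ab≡ with A (f b) Bool.≟ A (f a)
  ... | no ≢ = b , orbit-refl f , Ab≡ , ≢
  ... | yes Afb≡ = let b′ , o , r = go m (f b) (trans (shift m b) eq) Afb≡ in b′ , orbit-trans f (1 , refl) o , r

-- A is a union of components of the graph without colour 0, on black vertices; the cut set
-- consists of the colour-0 edges leaving A, and does not depend on the colour used to test this.
module CutSet (ps : Colouring n (suc q)) (valid : Valid ps) (A : Fin n → Bool)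
              (closed : Closed ps (nonzeroColours (suc q)) (T ∘ A)) where

  A∘σ : ∀ j k b → A (σ ps (suc j) b) ≡ A (σ ps (suc k) b)
  A∘σ j k b = T-ext (closed (∈-map⁺ suc (∈-allFin j)) (∈-map⁺ suc (∈-allFin k)) eq)
                    (closed (∈-map⁺ suc (∈-allFin k)) (∈-map⁺ suc (∈-allFin j)) (sym eq))
    where eq = trans (σ-spec ps valid (suc j) b) (sym (σ-spec ps valid (suc k) b))

  cut? : ∀ b → Dec (A b ≢ A (σ ps (suc zero) b))
  cut? b = ¬? (A b Bool.≟ A (σ ps (suc zero) b))

  cutSet : List (Fin n)
  cutSet = filter cut? (allFin n)

  cutSet-unique : Unique cutSet
  cutSet-unique = Unique.filter⁺ cut? (Unique.allFin⁺ n)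

  -- In every colour the cut set consists of the places where `A` changes along a `σ`-cycle, so
  -- `another-change` supplies a second one on the same cycle.
  cutSet-partner : ∀ j {a} → a ∈ cutSet → Partner (faces ps valid j) cutSet a
  cutSet-partner j {a} a∈ =
    let b , b≢a , o , Ab≢ = another-change (σ-injective ps valid (suc j)) A
          (λ eq → proj₂ (∈-filter⁻ cut? {xs = allFin n} a∈) (trans eq (A∘σ j zero a)))
    in b , ∈-filter⁺ cut? (∈-allFin b) (λ eq → Ab≢ (trans eq (A∘σ zero j b))) , b≢a , o

  -- If `A` changed nowhere it would be invariant under every `σ`, and `conn` would spread it from
  -- `r` to `b`.
  cutSet-nonempty : Family.Connected (faces ps valid) → ∀ {r b} → T (A r) → ¬ T (A b) → ∃ (_∈ cutSet)
  cutSet-nonempty conn {r} {b} Ar ¬Ab with any? (λ x → cut? x)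
  ... | yes (x , cut) = x , ∈-filter⁺ cut? (∈-allFin x) cut
  ... | no none = contradiction (conn (T ∘ A) invariant Ar) ¬Ab
    where
    invariant : ∀ j {a b} → Orbit (σ ps (suc j)) a b → T (A a) → T (A b)
    invariant j = orbit-induction (σ ps (suc j)) (T ∘ A) λ {b} Ab → subst T (step b) Ab
      where
      step : ∀ b → A b ≡ A (σ ps (suc j) b)
      step b with A b Bool.≟ A (σ ps (suc zero) b)
      ... | yes eq = trans eq (A∘σ zero j b)
      ... | no ≢ = contradiction (b , ≢) none

-- Chosen so that `σ` of colour `suc i` becomes followed first by the transposition of `x` and `y`,
-- then by that of `w` and `z`. In use the first cuts a common cycle of `x` and `y`, and the second
-- inserts the fixed point `z` into the part containing `w`.
rotate : Colouring n q → Fin q → (w x y z : Fin n) → Colouring n q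
rotate ps i w x y z = ps [ suc i ]≔ Vec.tabulate λ b → π ps (suc i) (transpose x y (transpose w z b))

unrotate : Colouring n q → Fin q → (w x y z : Fin n) → Colouring n q
unrotate ps i w x y z = ps [ suc i ]≔ Vec.tabulate λ b → π ps (suc i) (transpose w z (transpose x y b))

module _ (ps : Colouring n q) (i : Fin q) (w x y z : Fin n) where

  private ps′ = rotate ps i w x y z

  π-rotate : ∀ b → π ps′ (suc i) b ≡ π ps (suc i) (transpose x y (transpose w z b))
  π-rotate b = trans (cong (λ v → lookup v b) (lookup∘update (suc i) ps _)) (lookup∘tabulate _ b)

  π-rotate′ : ∀ {c} → c ≢ suc i → ∀ b → π ps′ c b ≡ π ps c b
  π-rotate′ c≢i b = cong (λ v → lookup v b) (lookup∘update′ c≢i ps _)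

  rotate-valid : Valid ps → Valid ps′
  rotate-valid valid c {a} {b} eq with c ≟ suc i
  ... | yes refl = transpose-injective w z (transpose-injective x y
                     (valid (suc i) (trans (sym (π-rotate a)) (trans eq (π-rotate b)))))
  ... | no c≢i = valid c (trans (sym (π-rotate′ c≢i a)) (trans eq (π-rotate′ c≢i b)))

  unrotate-rotate : unrotate ps′ i w x y z ≡ ps
  unrotate-rotate = vec-ext λ c → vec-ext (pointwise c)
    where
    pointwise : ∀ c b → π (unrotate ps′ i w x y z) c b ≡ π ps c b
    pointwise c b with c ≟ suc i
    ... | yes refl = trans (cong (λ v → lookup v b) (lookup∘update (suc i) ps′ _)) (trans (lookup∘tabulate _ b)
            (trans (π-rotate _) (cong (π ps (suc i)) (transpose-cancel w z x y b))))
    ... | no c≢i = trans (cong (λ v → lookup v b) (lookup∘update′ c≢i ps′ _)) (π-rotate′ c≢i b)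

classes-cong : {P Q : Partition n} → (∀ {a b} → _~_ P a b → _~_ Q a b) → (∀ {a b} → _~_ Q a b → _~_ P a b) →
               ∀ xs → classes P xs ≡ classes Q xs
classes-cong {P = P} {Q} P⇒Q Q⇒P xs = classes-transversal P {ts = reps Q xs}
  (AllPairs.map (λ ¬q → ¬q ∘ P⇒Q) (reps-indep Q xs))
  (meets-∈ P ∘ reps-⊆ Q xs) (Any.map Q⇒P ∘ reps-cover Q xs)

module Rotation (ps : Colouring n q) (valid : Valid ps) (i : Fin q) {x y z : Fin n}
                (x≢y : x ≢ y) (x~y : Orbit (σ ps (suc i)) x y) (fixed : σ ps (suc i) z ≡ z) where

  private
    σᵢ = σ ps (suc i)
    σᵢ-inj = σ-injective ps valid (suc i)

  fixed-orbit : ∀ {b} → Orbit σᵢ z b → z ≡ b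
  fixed-orbit o = orbit-induction σᵢ (z ≡_) (λ { refl → sym fixed }) o refl

  z≢x : z ≢ x
  z≢x refl = x≢y (fixed-orbit x~y)

  z≢y : z ≢ y
  z≢y refl = x≢y (sym (fixed-orbit (orbit-sym σᵢ σᵢ-inj x~y)))

  -- The intermediate permutation: `x` and `y` are separated, `z` is not yet inserted.
  τ : Fin n → Fin n
  τ b = transpose x y (σᵢ b)

  τ-injective : Injective _≡_ _≡_ τ
  τ-injective = σᵢ-inj ∘ transpose-injective x y

  τ-apart : ¬ Orbit τ x y
  τ-apart = transpose-apart σᵢ-inj τ-injective (λ _ → refl) x≢y x~y

  joins-xy : Joins (orbits τ τ-injective) (faces ps valid i) x y
  joins-xy = transpose-joins τ-injective σᵢ-inj (λ b → sym (transpose-involutive x y (σᵢ b))) τ-apart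

  τ-fixed : τ z ≡ z
  τ-fixed = trans (cong (transpose x y) fixed) (transpose-≢ x y z≢x z≢y)

  module At {w : Fin n} (w∈ : w ∈ x ∷ y ∷ []) where

    ps′ : Colouring n q
    ps′ = rotate ps i w x y z

    z≢w : z ≢ w
    z≢w = All.lookup (z≢x ∷ z≢y ∷ []) w∈

    -- What lets `z` be recovered from the new graph, `i` and `w`, since the colour-0 map of a valid
    -- colouring is injective.
    π-w : π ps′ (suc i) w ≡ π ps′ zero z
    π-w = trans (π-rotate ps i w x y z w) (trans (cong (π ps (suc i) ∘ transpose x y) (transpose-≡ˡ w z))
      (trans (cong (π ps (suc i)) (transpose-≢ x y z≢x z≢y))
        (trans (trans (cong (π ps (suc i)) (sym fixed)) (σ-spec ps valid (suc i) z))
            (sym (π-rotate′ ps i w x y z (λ ()) z)))))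

    module _ (valid′ : Valid ps′) where

      σ-rotate : ∀ b → σ ps′ (suc i) b ≡ transpose w z (τ b)
      σ-rotate b = σ-unique ps′ valid′ (trans (π-rotate ps i w x y z _)
        (trans (cong (π ps (suc i)) (transpose-cancel w z x y (σᵢ b)))
          (trans (σ-spec ps valid (suc i) b) (sym (π-rotate′ ps i w x y z (λ ()) b)))))

      σ-rotate′ : ∀ {j} → j ≢ i → ∀ b → σ ps′ (suc j) b ≡ σ ps (suc j) b
      σ-rotate′ j≢i b = σ-unique ps′ valid′ (trans (π-rotate′ ps i w x y z (j≢i ∘ Fin.suc-injective) _)
        (trans (σ-spec ps valid _ b) (sym (π-rotate′ ps i w x y z (λ ()) b))))

      joins-wz : Joins (orbits τ τ-injective) (faces ps′ valid′ i) w z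
      joins-wz = transpose-joins τ-injective (σ-injective ps′ valid′ (suc i)) σ-rotate
        λ o → z≢w (orbit-induction τ (z ≡_) (λ { refl → sym τ-fixed }) (orbit-sym τ τ-injective o) refl)

      same⇒ : ∀ {j} → j ≢ i → ∀ {a b} → Orbit (σ ps (suc j)) a b → Orbit (σ ps′ (suc j)) a b
      same⇒ j≢i = orbit-cong (λ b → sym (σ-rotate′ j≢i b))

      same⇐ : ∀ {j} → j ≢ i → ∀ {a b} → Orbit (σ ps′ (suc j)) a b → Orbit (σ ps (suc j)) a b
      same⇐ j≢i = orbit-cong (σ-rotate′ j≢i)

      -- In colour `i` the old and the new permutation each have one cycle fewer than `τ`; the other
      -- colours keep their cycles.
      total-rotate : Family.totalClasses (faces ps′ valid′) (allFin n) ≡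
                     Family.totalClasses (faces ps valid) (allFin n)
      total-rotate = sum-cong-≗ {q} step
        where
        step : ∀ j → classes (faces ps′ valid′ j) (allFin n) ≡ classes (faces ps valid j) (allFin n)
        step j with j ≟ i
        ... | yes refl = suc-injective (trans (sym (joins-classes joins-wz)) (joins-classes joins-xy))
        ... | no j≢i = classes-cong {P = faces ps′ valid′ j} {faces ps valid j} (same⇐ j≢i) (same⇒ j≢i)
            (allFin n)

      order-rotate : ∀ {d N} → Family.totalClasses (faces ps valid) (allFin n) + d ≡ N →
                     Family.totalClasses (faces ps′ valid′) (allFin n) + d ≡ N
      order-rotate {d} = trans (cong (_+ d) total-rotate)

      -- Pairs in other colours survive. In colour `i` a pair survives if it lies on one `τ`-cycle;
      -- otherwise its members lie on the `τ`-cycles of `x` and `y`, which the exception covers.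
      rotate-almostPaired : ∀ {X} → Unique X → (∀ j {a} → a ∈ X → Partner (faces ps valid j) X a) →
                            Family.AlmostPaired (faces ps′ valid′) X
      rotate-almostPaired {X} u paired = record
        { colour = i ; x = x ; y = y ; unique = u
        ; paired = λ {j} j≢i a∈ → let b , b∈ , b≢a , o = paired j a∈ in b , b∈ , b≢a , same⇒ j≢i o
        ; except = λ a∈ → except (paired i a∈) }
        where
        except : ∀ {a} → Partner (faces ps valid i) X a →
                 Meets (faces ps′ valid′ i) a (x ∷ y ∷ []) ⊎ Partner (faces ps′ valid′ i) X a
        except (b , b∈ , b≢a , a~b) with Joins.split joins-xy a~b
        ... | inj₁ o = inj₂ (b , b∈ , b≢a , Joins.include joins-wz o)
        ... | inj₂ (inj₁ a~x , _) = inj₁ (here (Joins.include joins-wz a~x))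
        ... | inj₂ (inj₂ a~y , _) = inj₁ (there (here (Joins.include joins-wz a~y)))

  Step : Fin n → Fin n → Set
  Step a b = Orbit τ a b ⊎ ∃ λ j → j ≢ i × Orbit (σ ps (suc j)) a b

  -- Only moves across the cut cycle are lost, and such a move ends on the `τ`-cycle of `x` or of
  -- `y`.
  reach : Family.Connected (faces ps valid) → ∀ b → Star Step x b ⊎ Star Step y b
  reach conn b = conn (λ b → Star Step x b ⊎ Star Step y b) extend {x} (inj₁ ε)
    where
    push : ∀ {b c} → Step b c → Star Step x b ⊎ Star Step y b → Star Step x c ⊎ Star Step y c
    push s (inj₁ p) = inj₁ (p ◅◅ (s ◅ ε))
    push s (inj₂ p) = inj₂ (p ◅◅ (s ◅ ε))
    extend : ∀ j {b c} → Orbit (σ ps (suc j)) b c → Star Step x b ⊎ Star Step y b → Star Step x c ⊎ Star Step y c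
    extend j o s with j ≟ i
    ... | no j≢i = push (inj₂ (j , j≢i , o)) s
    ... | yes refl with Joins.split joins-xy o
    ...   | inj₁ o′ = push (inj₁ o′) s
    ...   | inj₂ (_ , inj₁ c~x) = inj₁ (inj₁ (orbit-sym τ τ-injective c~x) ◅ ε)
    ...   | inj₂ (_ , inj₂ c~y) = inj₂ (inj₁ (orbit-sym τ τ-injective c~y) ◅ ε)

  -- `u` reaches `z`, and the new link from `z` to `w` leads on to everything reached from `w`.
  connect : ∀ {w u} → w ∈ x ∷ y ∷ [] → Star Step u z → (∀ b → Star Step u b ⊎ Star Step w b) →
            ∀ valid′ → Family.Connected (faces (rotate ps i w x y z) valid′)
  connect {w} {u} w∈ u⇝z all valid′ P closed {a} {b} Pa = proj₁ (from-u b) (proj₂ (from-u a) Pa)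
    where
    open At w∈
    E′ = faces ps′ valid′
    _↔_ : Fin n → Fin n → Set
    a ↔ b = (P a → P b) × (P b → P a)
    face↔ : ∀ j {a b} → _~_ (E′ j) a b → a ↔ b
    face↔ j o = closed j o , closed j (~-sym (E′ j) o)
    star↔ : ∀ {a b} → Star Step a b → a ↔ b
    star↔ ε = id , id
    star↔ (inj₁ o ◅ p) =
      let f , g = face↔ i (Joins.include (joins-wz valid′) o) ; f′ , g′ = star↔ p in f′ ∘ f , g ∘ g′
    star↔ (inj₂ (j , j≢i , o) ◅ p) =
      let f , g = face↔ j (same⇒ valid′ j≢i o) ; f′ , g′ = star↔ p in f′ ∘ f , g ∘ g′
    from-u : ∀ b → u ↔ b
    from-u b with all b
    ... | inj₁ p = star↔ p
    ... | inj₂ p =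
      let f , g = star↔ u⇝z ; f′ , g′ = face↔ i (Joins.join (joins-wz valid′)) ; f″ , g″ = star↔ p
      in f″ ∘ g′ ∘ f , g ∘ f′ ∘ g″

  -- Separating x from y may disconnect the graph; z is then on one side, and is linked to the
  -- representative w ∈ {x, y} of the other side.
  rotate-connected : Family.Connected (faces ps valid) →
    ∃ λ w → w ∈ x ∷ y ∷ [] × (∀ valid′ → Family.Connected (faces (rotate ps i w x y z) valid′))
  rotate-connected conn with reach conn z
  ... | inj₁ x⇝z = y , there (here refl) , connect (there (here refl)) x⇝z (reach conn)
  ... | inj₂ y⇝z = x , here refl , connect (here refl) y⇝z (λ b → swap (reach conn b))

fixedPoints : (Fin n → Fin n) → List (Fin n)
fixedPoints {n} f = filter (λ z → f z ≟ z) (allFin n)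

-- A point that is not fixed has its image as partner, so the fixed points are the only exceptions
-- to pairing.
orbits-≤-fixedPoints : (f : Fin n → Fin n) (inj : Injective _≡_ _≡_ f) →
  2 * classes (orbits f inj) (allFin n) ≤ n + length (fixedPoints f)
orbits-≤-fixedPoints {n} f inj = 
  subst (λ m → 2 * classes (orbits f inj) (allFin n) ≤ m + length (fixedPoints f)) (length-tabulate {n = n} id)
  (classes-paired-except (orbits f inj) {ys = fixedPoints f} (Unique.allFin⁺ n) λ {a} _ → aux a)
  where
  aux : ∀ a → Meets (orbits f inj) a (fixedPoints f) ⊎ Partner (orbits f inj) (allFin n) a
  aux a with f a ≟ a
  ... | yes eq = inj₁ (meets-∈ (orbits f inj) (∈-filter⁺ (λ z → f z ≟ z) (∈-allFin a) eq))
  ... | no ≢ = inj₂ (f a , ∈-allFin (f a) , ≢ , (1 , refl))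

hasOrder⇒ : ∀ {n t δ} (ps : Colouring n (3 + t)) (valid : Valid ps) {r : Fin n} → T (hasOrderᵇ δ (r , ps)) →
            Family.totalClasses (faces ps valid) (allFin n) + δ ≡ 1 + (2 + t) * n
hasOrder⇒ {n} {t} {δ} ps valid {r} ord =
  trans (cong (_+ δ) (sym (F₀≡totalClasses ps valid r))) (sym (≡ᵇ⇒≡ (1 + (2 + t) * n) _ ord))

hasOrder⇐ : ∀ {n t δ} (ps : Colouring n (3 + t)) (valid : Valid ps) {r : Fin n} →
            Family.totalClasses (faces ps valid) (allFin n) + δ ≡ 1 + (2 + t) * n → T (hasOrderᵇ δ (r , ps))
hasOrder⇐ {n} {t} {δ} ps valid {r} eq =
  ≡⇒≡ᵇ (1 + (2 + t) * n) _ (trans (sym eq) (cong (_+ δ) (sym (F₀≡totalClasses ps valid r))))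

-- Summing `orbits-≤-fixedPoints` over the colours and inserting `order` shows that
-- `(1 + t) * n + 2` is at most the number of fixed points plus `2 * δ`.
many-fixedPoints : ∀ {n t δ} (ps : Colouring n (3 + t)) (valid : Valid ps) →
  Family.totalClasses (faces ps valid) (allFin n) + δ ≡ 1 + (2 + t) * n →
  n ≤ sum (λ j → length (fixedPoints (σ ps (suc j)))) + 2 * δ
many-fixedPoints {n} {t} {δ} ps valid order = ≤-trans (m≤m+n n (t * n + 2))
    (+-cancelʳ-≤ ((3 + t) * n) _ _ (begin
  n + (t * n + 2) + (3 + t) * n        ≡⟨ sh₁ t n ⟩
  2 * (1 + (2 + t) * n)                ≡⟨ cong (2 *_) (sym order) ⟩
  2 * (total + δ)                      ≡⟨ *-distribˡ-+ 2 total δ ⟩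
  2 * total + 2 * δ
    ≡⟨ cong (_+ 2 * δ) (sym (sum-*ˡ 2 (λ j → classes (faces ps valid j) (allFin n)))) ⟩
  sum (λ j → 2 * classes (faces ps valid j) (allFin n)) + 2 * δ
    ≤⟨ +-monoˡ-≤ (2 * δ) (sum-mono-≤ λ j → orbits-≤-fixedPoints (σ ps (suc j)) (σ-injective ps valid (suc j))) ⟩
  sum (λ j → n + fix j) + 2 * δ
    ≡⟨ cong (_+ 2 * δ) (trans (∑-distrib-+ (λ _ → n) fix) (cong (_+ sum fix) (sum-const (3 + t) n))) ⟩
  (3 + t) * n + sum fix + 2 * δ        ≡⟨ sh₂ ((3 + t) * n) (sum fix) (2 * δ) ⟩
  sum fix + 2 * δ + (3 + t) * n        ∎))
  where
  open ≤-Reasoning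
  total = Family.totalClasses (faces ps valid) (allFin n)
  fix : Fin (3 + t) → ℕ
  fix j = length (fixedPoints (σ ps (suc j)))
  sh₁ : ∀ t n → n + (t * n + 2) + (3 + t) * n ≡ 2 * (1 + (2 + t) * n)
  sh₁ = solve-∀
  sh₂ : ∀ a b c → a + b + c ≡ b + c + a
  sh₂ = solve-∀

-- Labelled graphs

length-cartesianProductWith : (f : A → B → C) (xs : List A) (ys : List B) →
  length (cartesianProductWith f xs ys) ≡ length xs * length ys
length-cartesianProductWith f [] ys = refl
length-cartesianProductWith f (x ∷ xs) ys = trans (length-++ (map (f x) ys))
  (cong₂ _+_ (length-map (f x) ys) (length-cartesianProductWith f xs ys))

length-filter-map : {P : B → Set} (P? : ∀ b → Dec (P b)) (f : A → B) (xs : List A) →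
  length (filter P? (map f xs)) ≡ length (filter (P? ∘ f) xs)
length-filter-map P? f [] = refl
length-filter-map P? f (x ∷ xs) with does (P? (f x))
... | true = cong suc (length-filter-map P? f xs)
... | false = length-filter-map P? f xs

module _ {P : A × B → Set} (P? : ∀ p → Dec (P p)) (ys : List B) where

  private
    count : A → ℕ
    count x = length (filter (λ y → P? (x , y)) ys)

  length-filter-product-∷ : ∀ x xs → length (filter P? (cartesianProduct (x ∷ xs) ys)) ≡
                            count x + length (filter P? (cartesianProduct xs ys))
  length-filter-product-∷ x xs =
    trans (cong length (filter-++ P? (map (x ,_) ys) (cartesianProduct xs ys)))
      (trans (length-++ (filter P? (map (x ,_) ys))) (cong (_+ _) (length-filter-map P? (x ,_) ys)))

  length-filter-product-tabulate : ∀ {m} (f : Fin m → A) →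
    length (filter P? (cartesianProduct (tabulate f) ys)) ≡ sum (count ∘ f)
  length-filter-product-tabulate {zero} f = refl
  length-filter-product-tabulate {suc m} f = trans (length-filter-product-∷ (f zero) (tabulate (f ∘ suc)))
    (cong (count (f zero) +_) (length-filter-product-tabulate (f ∘ suc)))

  length-filter-product-≥ : ∀ {m} xs → (∀ {x} → x ∈ xs → m ≤ count x) →
    length xs * m ≤ length (filter P? (cartesianProduct xs ys))
  length-filter-product-≥ [] _ = z≤n
  length-filter-product-≥ (x ∷ xs) h = subst (_ ≤_) (sym (length-filter-product-∷ x xs))
    (+-mono-≤ (h (here refl)) (length-filter-product-≥ xs (h ∘ there)))

fibre-bound : (_≟ᴮ_ : DecidableEquality B) (f : A → B) {S : A → A → Set} {k : ℕ} →
  (∀ y {zs} → AllPairs S zs → All (λ z → f z ≡ y) zs → length zs ≤ k) →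
  ∀ ys {xs} → AllPairs S xs → (∀ {x} → x ∈ xs → f x ∈ ys) → length xs ≤ length ys * k
fibre-bound _≟ᴮ_ f fibre [] {[]} _ _ = z≤n
fibre-bound _≟ᴮ_ f fibre [] {x ∷ xs} _ h with () ← h (here refl)
fibre-bound _≟ᴮ_ f {k = k} fibre (y ∷ ys) {xs} S-xs h =
  subst (_≤ k + length ys * k) (length-filter-split at? xs)
    (+-mono-≤ (fibre y (AllPairs.filter⁺ at? S-xs) (All.all-filter at? xs))
      (fibre-bound _≟ᴮ_ f fibre ys (AllPairs.filter⁺ (¬? ∘ at?) S-xs) rest))
  where
  at? = λ x → f x ≟ᴮ y
  rest : ∀ {x} → x ∈ filter (¬? ∘ at?) xs → f x ∈ ys
  rest x∈ with ∈-filter⁻ (¬? ∘ at?) {xs = xs} x∈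
  ... | x∈xs , fx≢y with h x∈xs
  ...   | here fx≡y = contradiction fx≡y fx≢y
  ...   | there fx∈ = fx∈

_≟ᴳ_ : DecidableEquality (RGraph n q)
_≟ᴳ_ = ≡-dec _≟_ (Vec.≡-dec (Vec.≡-dec _≟_))

-- Double counting of rotations

module Labelled (t n δ : ℕ) where

  Graph : Set
  Graph = RGraph n (3 + t)

  graphs : List Graph
  graphs = filterᵇ (λ G → connectedᵇ G ∧ hasOrderᵇ δ G) (allRGraphs n (3 + t))

  nonSYK : List Graph
  nonSYK = filter (¬? ∘ T? ∘ SYKᵇ) graphs

  ∈-graphs⁻ : ∀ {r ps} → (r , ps) ∈ graphs → Valid ps × T (connectedᵇ (r , ps)) × T (hasOrderᵇ δ (r , ps))
  ∈-graphs⁻ G∈ = let G∈all , ok = ∈-filter⁻ (T? ∘ (λ G → connectedᵇ G ∧ hasOrderᵇ δ G)) {xs = allRGraphs n (3 + t)} G∈ in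
    ∈-allRGraphs⁻ G∈all , to T-∧ ok

  ∈-graphs⁺ : ∀ {r ps} → Valid ps → T (connectedᵇ (r , ps)) → T (hasOrderᵇ δ (r , ps)) → (r , ps) ∈ graphs
  ∈-graphs⁺ {r} {ps} valid conn ord =
    ∈-filter⁺ (T? ∘ (λ G → connectedᵇ G ∧ hasOrderᵇ δ G)) (∈-allRGraphs⁺ valid)
        (from (T-∧ {connectedᵇ (r , ps)}) (conn , ord))

  graphs-unique : Unique graphs
  graphs-unique = Unique.filter⁺ (T? ∘ (λ G → connectedᵇ G ∧ hasOrderᵇ δ G)) (allRGraphs-unique n (3 + t))

  -- A `Key` is an occasion for a rotation: a graph, a colour and a point, fixed in use. A `Code` is
  -- the new graph with the colour and the points `w`, `x`, `y`.
  Key Code : Set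
  Key = Graph × Fin (3 + t) × Fin n
  Code = Graph × Fin (3 + t) × Fin n × Fin n × Fin n

  decode : Code → Fin n → Graph
  decode ((r , ps) , i , w , x , y) z = r , unrotate ps i w x y z

  -- One rotation. `X` will be the cut set of the source; it is kept because it confines `w`, `x`
  -- and `y` to few values once the target is given.
  record Arrow : Set where
    field
      source target : Graph
      colour        : Fin (3 + t)
      w x y z       : Fin n
      X             : List (Fin n)
      source≡       : source ≡ decode (target , colour , w , x , y) z
      target∈       : target ∈ graphs
      π-w           : π (proj₂ target) (suc colour) w ≡ π (proj₂ target) zero z
      almostPaired  : ∀ valid → Family.AlmostPaired (faces (proj₂ target) valid) X
      w∈ : w ∈ X
      x∈ : x ∈ X
      y∈ : y ∈ X

    key : Key
    key = source , colour , z

    code : Code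
    code = target , colour , w , x , y

  open Arrow

  -- `π-w` determines `z` by injectivity of the colour-0 map of the target, and `decode` then
  -- returns the source.
  code-determines-key : ∀ a b → code a ≡ code b → key a ≡ key b
  code-determines-key a b eq = cong₂ (λ G (i , z) → G , i , z)
      (trans (source≡ a) (trans (cong₂ decode eq z≡) (sym (source≡ b))))
      (cong₂ _,_ (cong (proj₁ ∘ proj₂) eq) z≡)
    where
    same-z : ∀ {c c′ : Code} {z z′} → c ≡ c′ → Valid (proj₂ (proj₁ c)) →
             (let ((_ , ps) , i , w , _) = c in π ps (suc i) w ≡ π ps zero z) →
             (let ((_ , ps) , i , w , _) = c′ in π ps (suc i) w ≡ π ps zero z′) → z ≡ z′
    same-z refl valid p p′ = valid zero (trans (sym p) p′)
    z≡ : z a ≡ z b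
    z≡ = same-z eq (proj₁ (∈-graphs⁻ (target∈ a))) (π-w a) (π-w b)

  module _ {r : Fin n} {ps : Colouring n (3 + t)} (valid : Valid ps) (conn : Family.Connected (faces ps valid))
           (order : Family.totalClasses (faces ps valid) (allFin n) + δ ≡ 1 + (2 + t) * n)
           {S : List (Fin n)} (S-unique : Unique S)
           (paired : ∀ j {a} → a ∈ S → Partner (faces ps valid j) S a) where

    rotationArrow : ∀ {i a b c} → a ∈ S → b ∈ S → a ≢ b → Orbit (σ ps (suc i)) a b → σ ps (suc i) c ≡ c →
                    ∃ λ α → key α ≡ ((r , ps) , i , c)
    rotationArrow {i} {a} {b} {c} a∈ b∈ a≢b a~b fixed = build (rotate-connected conn)
      where
      open Rotation ps valid i {a} {b} {c} a≢b a~b fixed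
      build : (∃ λ d → d ∈ a ∷ b ∷ [] × (∀ valid′ → Family.Connected (faces (rotate ps i d a b c) valid′))) →
              ∃ λ α → key α ≡ ((r , ps) , i , c)
      build (d , d∈ , conn′) = record
        { source = r , ps ; target = r , rotate ps i d a b c ; colour = i ; w = d ; x = a ; y = b ; z = c ; X = S
        ; source≡ = cong (r ,_) (sym (unrotate-rotate ps i d a b c))
        ; target∈ = ∈-graphs⁺ {r} {rotate ps i d a b c} valid′
            (connected⇐ (rotate ps i d a b c) valid′ r (conn′ valid′))
                      (hasOrder⇐ {n} {t} {δ} (rotate ps i d a b c) valid′ {r}
                          (At.order-rotate d∈ valid′ {δ} {1 + (2 + t) * n} order))
        ; π-w = At.π-w d∈
        ; almostPaired = λ v → At.rotate-almostPaired d∈ v S-unique paired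
        ; w∈ = All.lookup (a∈ ∷ b∈ ∷ []) d∈ ; x∈ = a∈ ; y∈ = b∈ } , refl
        where
        valid′ : Valid (rotate ps i d a b c)
        valid′ = rotate-valid ps i d a b c valid

  -- Failure of `SYKᵇ` provides a closed set `A`. Any entry of its cut set, with a partner in colour
  -- `i`, serves as the pair to be separated.
  arrow : ∀ {r ps i z} → (r , ps) ∈ nonSYK → σ ps (suc i) z ≡ z → ∃ λ a → key a ≡ ((r , ps) , i , z)
  arrow {r} {ps} {i} {z} G∈ fixed =
    let G∈′ , ¬SYK = ∈-filter⁻ (¬? ∘ T? ∘ SYKᵇ) {xs = graphs} G∈
        valid , conn , ord = ∈-graphs⁻ {r} {ps} G∈′
    in build valid (connected⇒ ps valid r conn) (hasOrder⇒ {n} {t} {δ} ps valid {r} ord)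
         (disconnected {ps = ps} {nonzeroColours (3 + t)} {r} ¬SYK)
    where
    build : (valid : Valid ps) → Family.Connected (faces ps valid) →
            Family.totalClasses (faces ps valid) (allFin n) + δ ≡ 1 + (2 + t) * n →
            (∃ λ (A : Fin n → Bool) → T (A r) × Closed ps (nonzeroColours (3 + t)) (T ∘ A) ×
              ∃ λ b → ¬ T (A b)) →
            ∃ λ a → key a ≡ ((r , ps) , i , z)
    build valid conn order (A , Ar , closed , b , ¬Ab) =
      let a , a∈ = CutSet.cutSet-nonempty ps valid A closed conn Ar ¬Ab
          b , b∈ , b≢a , a~b = CutSet.cutSet-partner ps valid A closed i a∈
      in rotationArrow {r} {ps} valid conn order (CutSet.cutSet-unique ps valid A closed)
           (CutSet.cutSet-partner ps valid A closed) a∈ b∈ (≢-sym b≢a) a~b fixed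

  fixed? : (k : Key) → Dec (let ((_ , ps) , i , z) = k in σ ps (suc i) z ≡ z)
  fixed? ((_ , ps) , i , z) = σ ps (suc i) z ≟ z

  keys : List Key
  keys = filter fixed? (cartesianProduct nonSYK (cartesianProduct (allFin (3 + t)) (allFin n)))

  keys-unique : Unique keys
  keys-unique = Unique.filter⁺ fixed? (Unique.cartesianProduct⁺ (Unique.filter⁺ (¬? ∘ T? ∘ SYKᵇ) graphs-unique)
    (Unique.cartesianProduct⁺ (Unique.allFin⁺ (3 + t)) (Unique.allFin⁺ n)))

  keys-many : length nonSYK * (n ∸ 2 * δ) ≤ length keys
  keys-many = length-filter-product-≥ fixed? (cartesianProduct (allFin (3 + t)) (allFin n)) nonSYK
                λ {G} → outdegree G
    where
    outdegree : ∀ G → G ∈ nonSYK → n ∸ 2 * δ ≤ length (filter (λ y → fixed? (G , y))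
        (cartesianProduct (allFin (3 + t)) (allFin n)))
    outdegree (r , ps) G∈ =
      let G∈′ , _ = ∈-filter⁻ (¬? ∘ T? ∘ SYKᵇ) {xs = graphs} G∈
          valid , _ , ord = ∈-graphs⁻ G∈′
      in subst (n ∸ 2 * δ ≤_) (sym (length-filter-product-tabulate (λ y → fixed? ((r , ps) , y)) (allFin n) id))
           (m≤n+o⇒m∸n≤o _ (2 * δ) (≤-trans (many-fixedPoints ps valid (hasOrder⇒ ps valid {r} ord))
               (≤-reflexive (+-comm _ (2 * δ)))))

  arrows : ∃ λ as → map key as ≡ keys
  arrows = go (All.tabulate λ { {(r , ps) , i , z} k∈ →
      let k∈′ , fixed = ∈-filter⁻ fixed? {xs = cartesianProduct nonSYK
              (cartesianProduct (allFin (3 + t)) (allFin n))} k∈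
      in arrow (proj₁ (∈-cartesianProduct⁻ nonSYK _ k∈′)) fixed })
    where
    go : ∀ {ks} → All (λ k → ∃ λ a → key a ≡ k) ks → ∃ λ as → map key as ≡ ks
    go [] = [] , refl
    go ((a , eq) ∷ h) = let as , eqs = go h in a ∷ as , cong₂ _∷_ eq eqs

  size : ℕ
  size = δ + (2 * δ) * (2 * δ)

  Distinct : Arrow → Arrow → Set
  Distinct a b = key a ≢ key b

  -- Distinct keys have distinct codes, and with the target fixed a code is a colour and three
  -- entries of `U`.
  indegree-≤ : ∀ G {as} → AllPairs Distinct as → All (λ a → target a ≡ G) as →
    ∀ U → (∀ {a} → a ∈ as → w a ∈ U × x a ∈ U × y a ∈ U) →
    length as ≤ (3 + t) * (length U * (length U * length U))
  indegree-≤ G {as} distinct at U in-U = begin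
    length as       ≤⟨ length-≤-by {S = Distinct} {R = λ a c → code a ≡ c}
                         (λ {a} {b} k≢ p p′ → k≢ (code-determines-key a b
                             (trans p (sym p′)))) {as} {codes} distinct code∈ ⟩
    length codes    ≡⟨ length-map (G ,_) (cartesianProduct (allFin (3 + t)) U³) ⟩
    length (cartesianProduct (allFin (3 + t)) U³)
                    ≡⟨ length-cartesianProductWith _,_ (allFin (3 + t)) U³ ⟩
    length (allFin (3 + t)) * length U³
                    ≡⟨ cong₂ _*_ (length-tabulate {n = 3 + t} id)
                         (trans (length-cartesianProductWith _,_ U (cartesianProduct U U))
                                (cong (length U *_) (length-cartesianProductWith _,_ U U))) ⟩
    (3 + t) * (length U * (length U * length U)) ∎
    where
    open ≤-Reasoning
    U³ : List (Fin n × Fin n × Fin n)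
    U³ = cartesianProduct U (cartesianProduct U U)
    codes : List Code
    codes = map (G ,_) (cartesianProduct (allFin (3 + t)) U³)
    code∈ : ∀ {a} → a ∈ as → code a ∈ codes
    code∈ {a} a∈ = let w∈U , x∈U , y∈U = in-U a∈ in
      subst (λ H → (H , colour a , w a , x a , y a) ∈ codes) (sym (All.lookup at a∈))
        (∈-map⁺ (G ,_) (∈-cartesianProduct⁺ (∈-allFin (colour a))
            (∈-cartesianProduct⁺ w∈U (∈-cartesianProduct⁺ x∈U y∈U))))

  cutSets-bounded : ∀ {r ps as} → (r , ps) ∈ graphs → All (λ a → target a ≡ (r , ps)) as →
    ∃ λ U → length U ≤ size × (∀ {X′} → X′ ∈ map X as → ∀ {b} → b ∈ X′ → b ∈ U)
  cutSets-bounded {r} {ps} {as} G∈ at =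
    let valid , conn , ord = ∈-graphs⁻ {r} {ps} G∈ in
    Ordered.almostPaired-bounded {n} {t} {δ} (faces ps valid) (connected⇒ ps valid r conn)
      (hasOrder⇒ {n} {t} {δ} ps valid {r} ord) r {map X as}
          (All.map⁺ (All.map (λ {a} → move {r , ps} valid a) at))
    where
    move : ∀ {G : Graph} (valid : Valid (proj₂ G)) a → target a ≡ G →
           Family.AlmostPaired (faces (proj₂ G) valid) (X a)
    move valid a refl = almostPaired a valid

  indegree : ∀ G {as} → AllPairs Distinct as → All (λ a → target a ≡ G) as →
             length as ≤ (3 + t) * (size * (size * size))
  indegree G {[]} _ _ = z≤n
  indegree G {as@(a ∷ _)} distinct at =
    let U , U≤ , sub = cutSets-bounded {proj₁ G} {proj₂ G} {as}
            (subst (_∈ graphs) (All.head at) (target∈ a)) at in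
    ≤-trans (indegree-≤ G {as} distinct at U
              (λ {b} b∈ → sub (∈-map⁺ X b∈) (w∈ b) , sub (∈-map⁺ X b∈) (x∈ b) , sub (∈-map⁺ X b∈) (y∈ b)))
      (*-monoʳ-≤ (3 + t) (*-mono-≤ U≤ (*-mono-≤ U≤ U≤)))

  arrows-bound : ∀ {as} → map key as ≡ keys → length keys ≤ length graphs * ((3 + t) * (size * (size * size)))
  arrows-bound {as} eq = subst (_≤ length graphs * ((3 + t) * (size * (size * size))))
      (trans (sym (length-map key as)) (cong length eq))
    (fibre-bound _≟ᴳ_ target {Distinct} indegree graphs {as}
        (AllPairs.map⁻ (subst Unique (sym eq) keys-unique)) (λ {a} _ → target∈ a))

  -- Counted by source, each graph outside SYK has at least `n ∸ 2 * δ` arrows; counted by target,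
  -- `indegree` bounds the arrows into any graph independently of `n`.
  nonSYK-bound : length nonSYK * (n ∸ 2 * δ) ≤ length graphs * ((3 + t) * (size * (size * size)))
  nonSYK-bound = ≤-trans keys-many (arrows-bound (proj₂ arrows))

-- Isomorphism classes

-- As with `search`, abstracting both lists gives a name to the local function of `countClasses`.
-- The first list argument of `countFrom` is the list on which `countClasses` was called.
mutual
  countFrom : {A : Set} → (A → A → Bool) → List A → List A → List A → ℕ
  countFrom = _

  countClasses≡countFrom : {A : Set} (eq : A → A → Bool) (x : A) (xs : List A) →
    countClasses eq (x ∷ xs) ≡ suc (countFrom eq (x ∷ xs) (x ∷ []) xs)
  countClasses≡countFrom eq x xs with x ∷ xs | [ x ]
  ... | p | s = refl

module _ {A : Set} {_~_ : A → A → Set} (~-equiv : IsEquivalence _~_) {eq : A → A → Bool}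
         (sound : ∀ {a b} → T (eq a b) → a ~ b) (complete : ∀ {a b} → a ~ b → T (eq a b)) where

  private module ~ = IsEquivalence ~-equiv

  countFrom-transversal : ∀ p seen ys → ∃ λ R → countFrom eq p seen ys ≡ length R × (∀ {r} → r ∈ R → r ∈ ys) ×
    AllPairs (λ a b → ¬ a ~ b) R × All (λ r → ¬ Any (r ~_) seen) R ×
        (∀ {y} → y ∈ ys → Any (y ~_) seen ⊎ Any (y ~_) R)
  countFrom-transversal p seen [] = [] , refl , (λ ()) , [] , [] , λ ()
  countFrom-transversal p seen (y ∷ ys) with any (eq y) seen in t
  ... | true =
    let R , len , sub , ind , new , cov = countFrom-transversal p seen ys
    in R , len , there ∘ sub , ind , new
     , λ { (here refl) → inj₁ (Any.map sound (Any.any⁻ (eq y) seen (from Bool.T-≡ t))) ; (there y∈) → cov y∈ }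
  ... | false =
    let R , len , sub , ind , new , cov = countFrom-transversal p (y ∷ seen) ys
    in y ∷ R , cong suc len , (λ { (here refl) → here refl ; (there r∈) → there (sub r∈) })
     , All.map (λ ¬m y~r → ¬m (here (~.sym y~r))) new ∷ ind
     , (λ m → subst T t (Any.any⁺ (eq y) (Any.map complete m))) ∷ All.map (λ ¬m m → ¬m (there m)) new
     , λ { (here refl) → inj₂ (here ~.refl) ; (there y∈) → shift (cov y∈) }
    where
    shift : ∀ {z R} → Any (z ~_) (y ∷ seen) ⊎ Any (z ~_) R → Any (z ~_) seen ⊎ Any (z ~_) (y ∷ R)
    shift (inj₁ (here z~y)) = inj₂ (here z~y)
    shift (inj₁ (there m)) = inj₁ m
    shift (inj₂ m) = inj₂ (there m)

  countClasses-transversal : ∀ xs → ∃ λ R → countClasses eq xs ≡ length R × (∀ {r} → r ∈ R → r ∈ xs) ×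
    AllPairs (λ a b → ¬ a ~ b) R × (∀ {y} → y ∈ xs → Any (y ~_) R)
  countClasses-transversal [] = [] , refl , (λ ()) , [] , λ ()
  countClasses-transversal (x ∷ xs) =
    let R , len , sub , ind , new , cov = countFrom-transversal (x ∷ xs) (x ∷ []) xs
    in x ∷ R , trans (countClasses≡countFrom eq x xs) (cong suc len)
     , (λ { (here refl) → here refl ; (there r∈) → there (sub r∈) })
     , All.map (λ ¬m x~r → ¬m (here (~.sym x~r))) new ∷ ind
     , λ { (here refl) → here ~.refl ; (there y∈) → join (cov y∈) }
    where
    join : ∀ {z R} → Any (z ~_) (x ∷ []) ⊎ Any (z ~_) R → Any (z ~_) (x ∷ R)
    join (inj₁ (here z~x)) = here z~x
    join (inj₂ m) = there m

record Iso (G G′ : RGraph n q) : Set where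
  field
    α β         : Fin n → Fin n
    α-injective : Injective _≡_ _≡_ α
    β-injective : Injective _≡_ _≡_ β
    root        : α (proj₁ G) ≡ proj₁ G′
    edge        : ∀ c b → β (π (proj₂ G) c b) ≡ π (proj₂ G′) c (α b)

iso-refl : {G : RGraph n q} → Iso G G
iso-refl = record { α = id ; β = id ; α-injective = id ; β-injective = id ; root = refl ; edge = λ _ _ → refl }

iso-trans : {G H K : RGraph n q} → Iso G H → Iso H K → Iso G K
iso-trans i j = record
  { α = J.α ∘ I.α ; β = J.β ∘ I.β ; α-injective = I.α-injective ∘ J.α-injective ; β-injective = I.β-injective ∘ J.β-injective
  ; root = trans (cong J.α I.root) J.root ; edge = λ c b → trans (cong J.β (I.edge c b)) (J.edge c (I.α b)) }
  where
  module I = Iso i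
  module J = Iso j

inverse : {f : Fin n → Fin n} → Injective _≡_ _≡_ f →
          ∃ λ (h : Fin n → Fin n) → (∀ b → f (h b) ≡ b) × (∀ b → h (f b) ≡ b) × Injective _≡_ _≡_ h
inverse {f = f} inj = h , fh , (λ b → inj (fh (f b))) , λ {a} {b} eq → trans (sym (fh a))
    (trans (cong f eq) (fh b))
  where
  h = λ b → proj₁ (surjective inj b)
  fh = λ b → proj₂ (surjective inj b)

iso-sym : {G H : RGraph n q} → Iso G H → Iso H G
iso-sym {G = G} {H} i =
  let α⁻¹ , αα⁻¹ , α⁻¹α , α⁻¹-inj = inverse α-injective
      β⁻¹ , _ , β⁻¹β , β⁻¹-inj = inverse β-injective
  in record { α = α⁻¹ ; β = β⁻¹ ; α-injective = α⁻¹-inj ; β-injective = β⁻¹-inj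
            ; root = trans (cong α⁻¹ (sym root)) (α⁻¹α (proj₁ G))
            ; edge = λ c b → trans (cong β⁻¹ (trans (cong (π (proj₂ H) c) (sym (αα⁻¹ b)))
                (sym (edge c (α⁻¹ b))))) (β⁻¹β _) }
  where open Iso i

iso-cong : {G H K : RGraph n q} → H ≡ K → Iso G H → Iso G K
iso-cong eq i = record
  { α = α ; β = β ; α-injective = α-injective ; β-injective = β-injective
  ; root = trans root (cong proj₁ eq) ; edge = λ c b → trans (edge c b) (cong (λ K → π (proj₂ K) c (α b)) eq) }
  where open Iso i

iso-equivalence : IsEquivalence (Iso {n} {q})
iso-equivalence = record { refl = iso-refl ; sym = iso-sym ; trans = iso-trans }

isoᵇ-sound : {G H : RGraph n q} → T (isoᵇ G H) → Iso G H
isoᵇ-sound {n} {q} {r , ps} {r′ , ps′} t with find (Any.any⁻ _ (Perms n) t)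
... | u , u∈ , t₁ with find (Any.any⁻ _ (Perms n) t₁)
...   | v , v∈ , t₂ with to (T-∧ {lookup u r == r′}) t₂
...     | t₃ , t₄ = record
  { α = lookup u ; β = lookup v ; α-injective = ∈-Perms⁻ u∈ ; β-injective = ∈-Perms⁻ v∈ ; root = ==⇒≡ t₃
  ; edge = λ c b → ==⇒≡ (All.lookup (All.all⁺ _ (allFin n)
      (All.lookup (All.all⁺ _ (allFin (suc q)) t₄) (∈-allFin c))) (∈-allFin b)) }

tabulate-injective : {f : Fin n → Fin n} → Injective _≡_ _≡_ f → Injective _≡_ _≡_ (lookup (Vec.tabulate f))
tabulate-injective {f = f} inj {a} {b} eq = inj (trans (sym (lookup∘tabulate f a))
    (trans eq (lookup∘tabulate f b)))

isoᵇ-complete : {G H : RGraph n q} → Iso G H → T (isoᵇ G H)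
isoᵇ-complete {n} {q} {r , ps} {r′ , ps′} i =
  Any.any⁺ _ (lose (∈-Perms⁺ {v = u} (tabulate-injective α-injective))
    (Any.any⁺ _ (lose (∈-Perms⁺ {v = v} (tabulate-injective β-injective))
      (from (T-∧ {lookup u r == r′}) (≡⇒== {i = lookup u r} (trans (lookup∘tabulate α r) root) ,
        All.all⁻ _ (All.tabulate {xs = allFin (suc q)} λ {c} _ → All.all⁻ _
            (All.tabulate {xs = allFin n} λ {b} _ →
          ≡⇒== {i = lookup v (π ps c b)} (trans (lookup∘tabulate β _)
              (trans (edge c b) (cong (π ps′ c) (sym (lookup∘tabulate α b))))))))))))
  where
  open Iso i
  u = Vec.tabulate α
  v = Vec.tabulate β

-- Relabelling of black vertices by `u` and white vertices by `v`; `invAt u b b` is the old label of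
-- the black vertex `b`.
act : Vec (Fin n) n → Vec (Fin n) n → RGraph n q → RGraph n q
act u v (r , ps) = lookup u r , Vec.tabulate λ c → Vec.tabulate λ b → lookup v (π ps c (invAt u b b))

act-π : (u v : Vec (Fin n) n) (G : RGraph n q) → ∀ c b →
        π (proj₂ (act u v G)) c b ≡ lookup v (π (proj₂ G) c (invAt u b b))
act-π u v (r , ps) c b = trans (cong (λ p → lookup p b)
    (lookup∘tabulate (λ c → Vec.tabulate λ b → lookup v (π ps c (invAt u b b))) c))
  (lookup∘tabulate (λ b → lookup v (π ps c (invAt u b b))) b)

act-iso : {u v : Vec (Fin n) n} → u ∈ Perms n → v ∈ Perms n → (G : RGraph n q) → Iso G (act u v G)
act-iso {u = u} {v} u∈ v∈ G = record
  { α = lookup u ; β = lookup v ; α-injective = ∈-Perms⁻ u∈ ; β-injective = ∈-Perms⁻ v∈ ; root = refl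
  ; edge = λ c b → sym (trans (act-π u v G c (lookup u b))
      (cong (lookup v ∘ π (proj₂ G) c) (∈-Perms⁻ u∈ (invAt-spec {v = u} (∈-Perms⁻ u∈) (lookup u b)
          (lookup u b))))) }

iso-act : {G H : RGraph n q} → Iso G H → ∃₂ λ u v → u ∈ Perms n × v ∈ Perms n × act u v G ≡ H
iso-act {G = G} {H} i = u , v , u∈ , v∈ , cong₂ _,_ (trans (lookup∘tabulate α _) root)
    (vec-ext λ c → vec-ext λ b →
    trans (act-π u v G c b) (trans (lookup∘tabulate β _) (trans (edge c _)
      (cong (π (proj₂ H) c) (trans (sym (lookup∘tabulate α _)) (invAt-spec {v = u} (∈-Perms⁻ u∈) b b))))))
  where
  open Iso i
  u = Vec.tabulate α
  v = Vec.tabulate β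
  u∈ = ∈-Perms⁺ {v = u} (tabulate-injective α-injective)
  v∈ = ∈-Perms⁺ {v = v} (tabulate-injective β-injective)

iso-valid : {G H : RGraph n q} → Iso G H → Valid (proj₂ G) → Valid (proj₂ H)
iso-valid {G = G} {H} i valid c {a} {b} eq =
  let a′ , a≡ = surjective α-injective a
      b′ , b≡ = surjective α-injective b
      eq′ = trans (edge c a′) (trans (cong (π (proj₂ H) c) a≡)
          (trans eq (trans (cong (π (proj₂ H) c) (sym b≡)) (sym (edge c b′)))))
  in trans (sym a≡) (trans (cong α (valid c (β-injective eq′))) b≡)
  where open Iso i

-- A closed proper set containing the root of `H` pulls back along `α` to one containing the root of
-- `G`.
iso-connected : ∀ C {G H : RGraph n q} → Iso G H → T (connectedWithᵇ C G) → T (connectedWithᵇ C H)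
iso-connected C {G@(r , ps)} {H@(r′ , ps′)} i t = decidable-stable (T? (connectedWithᵇ C H)) λ ¬t →
  let A , Ar , closed , b , ¬Ab = disconnected {ps = ps′} {C} {r′} ¬t
      b′ , b≡ = surjective α-injective b
  in ¬Ab (subst (T ∘ A) b≡ (connected-elim {ps = ps} {C} {r} t (T ∘ A ∘ α)
       (λ {c} {d} {a} {a′} c∈ d∈ eq → closed c∈ d∈ (trans (sym (edge c a)) (trans (cong β eq) (edge d a′))))
       (subst (T ∘ A) (sym root) Ar) b′))
  where open Iso i

-- Two isomorphisms agree at the root, and agreement passes along edges. For relabellings this is
-- freeness of the action.
iso-unique : {G H : RGraph n q} → T (connectedᵇ G) → Valid (proj₂ G) → Valid (proj₂ H) → (i j : Iso G H) →
             (∀ b → Iso.α i b ≡ Iso.α j b) × (∀ w → Iso.β i w ≡ Iso.β j w)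
iso-unique {q = q} {G@(r , ps)} {H@(_ , ps′)} t valid valid′ i j = α≗ , λ w →
    let b , eq = surjective (valid zero) w
    in subst (λ w → I.β w ≡ J.β w) eq (trans (I.edge zero b)
        (trans (cong (π ps′ zero) (α≗ b)) (sym (J.edge zero b))))
  where
  module I = Iso i
  module J = Iso j
  α≗ : ∀ b → I.α b ≡ J.α b
  α≗ = connected-elim {ps = ps} {allColours q} {r} t (λ b → I.α b ≡ J.α b)
    (λ {c} {d} {b} {b′} _ _ eq α≡ → valid′ d (trans (sym (I.edge d b′))
        (trans (cong I.β (sym eq)) (trans (I.edge c b)
      (trans (cong (π ps′ c) α≡) (trans (sym (J.edge c b)) (trans (cong J.β eq) (J.edge d b′))))))))
    (trans I.root (sym J.root))

classes-iso : {P Q : Partition n} {α : Fin n → Fin n} → Injective _≡_ _≡_ α →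
  (∀ {a b} → _~_ P a b → _~_ Q (α a) (α b)) → (∀ {a b} → _~_ Q (α a) (α b) → _~_ P a b) →
  classes Q (allFin n) ≡ classes P (allFin n)
classes-iso {n} {P} {Q} {α} inj P⇒Q Q⇒P = trans
  (classes-transversal Q {allFin n} {map α (reps P (allFin n))}
    (AllPairs.map⁺ (AllPairs.map (λ ¬p → ¬p ∘ Q⇒P) (reps-indep P (allFin n))))
    (λ {a} _ → meets-∈ Q (∈-allFin a))
    (λ {b} _ → let a , eq = surjective inj b in
       subst (λ b → Meets Q b (map α (reps P (allFin n)))) eq
           (Any.map⁺ (Any.map P⇒Q (reps-cover P (allFin n) (∈-allFin a))))))
  (length-map α (reps P (allFin n)))

-- `α` conjugates each `σ` of `G` to that of `H`, so it carries cycles to cycles.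
iso-F₀ : {G H : RGraph n q} → Valid (proj₂ G) → Iso G H → F₀ H ≡ F₀ G
iso-F₀ {n} {q} {r , ps} {r′ , ps′} valid i = trans (F₀≡totalClasses ps′ valid′ r′) (trans
  (sum-cong-≗ {q} λ j → classes-iso {P = faces ps valid j} {faces ps′ valid′ j} {α} α-injective (push j)
      (pull j))
  (sym (F₀≡totalClasses ps valid r)))
  where
  open Iso i
  valid′ = iso-valid i valid
  σ-α : ∀ c b → σ ps′ c (α b) ≡ α (σ ps c b)
  σ-α c b = σ-unique ps′ valid′ (trans (sym (edge c _)) (trans (cong β (σ-spec ps valid c b)) (edge zero b)))
  iter-α : ∀ c k a → iter k (σ ps′ c) (α a) ≡ α (iter k (σ ps c) a)
  iter-α c zero a = refl
  iter-α c (suc k) a = trans (cong (σ ps′ c) (iter-α c k a)) (σ-α c _)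
  push : ∀ j {a b} → Orbit (σ ps (suc j)) a b → Orbit (σ ps′ (suc j)) (α a) (α b)
  push j (k , refl) = k , iter-α (suc j) k _
  pull : ∀ j {a b} → Orbit (σ ps′ (suc j)) (α a) (α b) → Orbit (σ ps (suc j)) a b
  pull j (k , eq) = k , α-injective (trans (sym (iter-α (suc j) k _)) eq)

labellings : ℕ → ℕ
labellings n = length (Perms n) * length (Perms n)

-- The relabelling group acts freely, so every isomorphism class has the same number of members.
classes*labellings : (p : RGraph n q → Bool) → (∀ {G} → T (p G) → T (connectedᵇ G)) →
  (∀ {G H} → Valid (proj₂ G) → Iso G H → T (p G) → T (p H)) →
  countClasses isoᵇ (filterᵇ p (allRGraphs n q)) * labellings n ≡ length (filterᵇ p (allRGraphs n q))
classes*labellings {n} {q} p p⇒connected p-iso =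
  let R , len , R⊆ , R-ind , cov = countClasses-transversal iso-equivalence {isoᵇ}
        (λ {G} {H} → isoᵇ-sound {G = G} {H}) (λ {G} {H} → isoᵇ-complete {G = G} {H}) L
  in trans (cong (_* labellings n) len) (counted R R⊆ R-ind cov)
  where
  L : List (RGraph n q)
  L = filterᵇ p (allRGraphs n q)
  L-unique : Unique L
  L-unique = Unique.filter⁺ (T? ∘ p) (allRGraphs-unique n q)
  ∈L⁻ : ∀ {G} → G ∈ L → Valid (proj₂ G) × T (p G)
  ∈L⁻ {r , ps} G∈ = let G∈′ , t = ∈-filter⁻ (T? ∘ p) {xs = allRGraphs n q} G∈ in ∈-allRGraphs⁻ G∈′ , t
  L-closed : ∀ {G H} → G ∈ L → Iso G H → H ∈ L
  L-closed {G} {H} G∈ i = let valid , t = ∈L⁻ G∈ in ∈-filter⁺ (T? ∘ p) (∈-allRGraphs⁺ (iso-valid i valid)) (p-iso valid i t)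

  Labelling : Set
  Labelling = RGraph n q × Vec (Fin n) n × Vec (Fin n) n
  apply : Labelling → RGraph n q
  apply (G , u , v) = act u v G

  module _ (R : List (RGraph n q)) (R⊆ : ∀ {r} → r ∈ R → r ∈ L) (R-ind : AllPairs (λ G H → ¬ Iso G H) R)
           (cov : ∀ {G} → G ∈ L → Any (Iso G) R) where

    labelled : List Labelling
    labelled = cartesianProduct R (cartesianProduct (Perms n) (Perms n))

    same-labels : ∀ {H u v u′ v′} → H ∈ L → u ∈ Perms n → v ∈ Perms n → u′ ∈ Perms n → v′ ∈ Perms n →
                  act u v H ≡ act u′ v′ H → u ≡ u′ × v ≡ v′
    same-labels {H} {u} {v} {u′} {v′} H∈ u∈ v∈ u∈′ v∈′ eq =
      let valid , t = ∈L⁻ H∈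
          α≗ , β≗ = iso-unique {G = H} {act u v H} (p⇒connected t) valid (iso-valid (act-iso u∈ v∈ H) valid)
                      (act-iso u∈ v∈ H) (iso-cong (sym eq) (act-iso u∈′ v∈′ H))
      in vec-ext α≗ , vec-ext β≗

    -- Equal images make the representatives isomorphic, hence equal by independence of `R`;
    -- rigidity then identifies the labels.
    apply-injective : ∀ {x y} → x ∈ labelled → y ∈ labelled → apply x ≡ apply y → x ≡ y
    apply-injective {G , u , v} {H , u′ , v′} x∈ y∈ eq =
      let G∈ , uv∈ = ∈-cartesianProduct⁻ R (cartesianProduct (Perms n) (Perms n)) x∈
          H∈ , uv∈′ = ∈-cartesianProduct⁻ R (cartesianProduct (Perms n) (Perms n)) y∈
          u∈ , v∈ = ∈-cartesianProduct⁻ (Perms n) (Perms n) uv∈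
          u∈′ , v∈′ = ∈-cartesianProduct⁻ (Perms n) (Perms n) uv∈′
          G≡H = allPairs-unique {_~_ = Iso} iso-sym R-ind G∈ H∈
                  (iso-trans (iso-cong eq (act-iso u∈ v∈ G)) (iso-sym (act-iso u∈′ v∈′ H)))
          u≡ , v≡ = same-labels (R⊆ H∈) u∈ v∈ u∈′ v∈′ (subst (λ G → act u v G ≡ act u′ v′ H) G≡H eq)
      in cong₂ _,_ G≡H (cong₂ _,_ u≡ v≡)

    labelled≤ : length labelled ≤ length L
    labelled≤ = length-≤-by {S = λ x y → apply x ≢ apply y} {R = λ x G → apply x ≡ G}
        (λ ≢ p p′ → ≢ (trans p (sym p′)))
      {labelled} {L}
      (allPairs⁺ {P = _∈ labelled} (λ x∈ y∈ x≢y eq → x≢y (apply-injective x∈ y∈ eq)) (All.tabulate id)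
        (Unique.cartesianProduct⁺ R-unique (Unique.cartesianProduct⁺ (Perms-unique n) (Perms-unique n))))
      apply∈
      where
      R-unique : Unique R
      R-unique = AllPairs.map (λ { ¬i refl → ¬i iso-refl }) R-ind
      apply∈ : ∀ {x} → x ∈ labelled → apply x ∈ L
      apply∈ {G , u , v} x∈ =
        let G∈ , uv∈ = ∈-cartesianProduct⁻ R (cartesianProduct (Perms n) (Perms n)) x∈
            u∈ , v∈ = ∈-cartesianProduct⁻ (Perms n) (Perms n) uv∈
        in L-closed (R⊆ G∈) (act-iso u∈ v∈ G)

    labelled≥ : length L ≤ length labelled
    labelled≥ = length-≤-by {S = _≢_} {R = λ G x → apply x ≡ G}
        (λ ≢ p p′ → ≢ (trans (sym p) p′)) {L} {labelled} L-unique found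
      where
      found : ∀ {G} → G ∈ L → Any (λ x → apply x ≡ G) labelled
      found G∈ =
        let H , H∈ , i = find (cov G∈)
            u , v , u∈ , v∈ , eq = iso-act (iso-sym i)
        in lose (∈-cartesianProduct⁺ H∈ (∈-cartesianProduct⁺ u∈ v∈)) eq

    counted : length R * labellings n ≡ length L
    counted = trans (sym (trans (length-cartesianProductWith _,_ R (cartesianProduct (Perms n) (Perms n)))
        (cong (length R *_) (length-cartesianProductWith _,_ (Perms n) (Perms n)))))
      (≤-antisym labelled≤ labelled≥)

-- Comparison of the two counts and the limit

Perms-nonempty : ∀ n → 1 ≤ length (Perms n)
Perms-nonempty n with Perms n | ∈-Perms⁺ {v = Vec.tabulate id} (tabulate-injective {n = n} {id} id)
... | _ ∷ _ | _ = s≤s z≤n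

filterᵇ-∧ : {A : Set} (p r : A → Bool) (xs : List A) → filterᵇ (λ x → p x ∧ r x) xs ≡ filterᵇ r (filterᵇ p xs)
filterᵇ-∧ p r [] = refl
filterᵇ-∧ p r (x ∷ xs) with p x
... | false = filterᵇ-∧ p r xs
... | true with r x
...   | false = filterᵇ-∧ p r xs
...   | true = cong (x ∷_) (filterᵇ-∧ p r xs)

module _ (t n δ : ℕ) where
  open Labelled t n δ

  hasOrder-iso : {G H : Graph} → Valid (proj₂ G) → Iso G H → T (hasOrderᵇ δ G) → T (hasOrderᵇ δ H)
  hasOrder-iso {G} {H} valid i = subst (λ m → T ((1 + (2 + t) * n) ≡ᵇ (m + δ)))
      (sym (iso-F₀ {G = G} {H} valid i))

  g*labellings : g (3 + t) n δ * labellings n ≡ length graphs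
  g*labellings = classes*labellings (λ G → connectedᵇ G ∧ hasOrderᵇ δ G)
      (λ {G} → proj₁ ∘ to (T-∧ {connectedᵇ G}))
    λ {G} {H} valid i tt → let conn , ord = to (T-∧ {connectedᵇ G}) tt in
      from (T-∧ {connectedᵇ H}) (iso-connected (allColours (3 + t)) i conn , hasOrder-iso valid i ord)

  c*labellings : c (3 + t) n δ * labellings n ≡ length (filterᵇ SYKᵇ graphs)
  c*labellings = trans (classes*labellings (λ G → connectedᵇ G ∧ hasOrderᵇ δ G ∧ SYKᵇ G)
      (λ {G} → proj₁ ∘ to (T-∧ {connectedᵇ G}))
    λ {G} {H} valid i tt → let conn , tt′ = to (T-∧ {connectedᵇ G}) tt ; ord , syk = to (T-∧ {hasOrderᵇ δ G}) tt′ in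
      from (T-∧ {connectedᵇ H}) (iso-connected (allColours (3 + t)) i conn ,
        from (T-∧ {hasOrderᵇ δ H}) (hasOrder-iso valid i ord , iso-connected (nonzeroColours (3 + t)) i syk)))
    (cong length (trans (filterᵇ-∧ connectedᵇ (λ G → hasOrderᵇ δ G ∧ SYKᵇ G) Gs)
      (trans (filterᵇ-∧ (hasOrderᵇ δ) SYKᵇ (filterᵇ connectedᵇ Gs))
          (cong (filterᵇ SYKᵇ) (sym (filterᵇ-∧ connectedᵇ (hasOrderᵇ δ) Gs))))))
    where Gs = allRGraphs n (3 + t)

  -- Both class counts carry the same factor `labellings n`, so the comparison reduces to splitting
  -- the labelled graphs by `SYKᵇ`.
  difference : ∣ c (3 + t) n δ - g (3 + t) n δ ∣ * labellings n ≡ length nonSYK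
  difference = begin
    ∣ c (3 + t) n δ - g (3 + t) n δ ∣ * labellings n
      ≡⟨ *-distribʳ-∣-∣ (labellings n) (c (3 + t) n δ) (g (3 + t) n δ) ⟩
    ∣ c (3 + t) n δ * labellings n - g (3 + t) n δ * labellings n ∣
      ≡⟨ cong₂ ∣_-_∣ c*labellings g*labellings ⟩
    ∣ length (filterᵇ SYKᵇ graphs) - length graphs ∣
      ≡⟨ cong (λ m → ∣ length (filterᵇ SYKᵇ graphs) - m ∣) (sym (length-filter-split (T? ∘ SYKᵇ) graphs)) ⟩
    ∣ length (filterᵇ SYKᵇ graphs) - (length (filterᵇ SYKᵇ graphs) + length nonSYK) ∣
      ≡⟨ ∣m-m+n∣≡n (length (filterᵇ SYKᵇ graphs)) (length nonSYK) ⟩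
    length nonSYK                                                          ∎
    where open ≡-Reasoning

-- Asymptotic equivalence without division: for each tolerance `1 / (k + 1)` the difference is
-- eventually at most that share of `g q n δ`.
theorem4p12 : (q δ : ℕ) → 3 ≤ q → 1 ≤ δ →
    (k : ℕ) → ∃[ N ] ((n : ℕ) → N ≤ n →
    suc k * ∣ c q n δ - g q n δ ∣ ≤ g q n δ)
theorem4p12 (suc (suc (suc t))) (suc δ′) (s≤s (s≤s (s≤s _))) _ k = 2 * δ + suc k * M , bound
  where
  δ = suc δ′
  s = δ + (2 * δ) * (2 * δ)
  -- `M` bounds the number of arrows into one graph; from the chosen threshold on, `n ∸ 2 * δ` is at
  -- least `suc k * M`.
  M = (3 + t) * (s * (s * s))
  bound : ∀ n → 2 * δ + suc k * M ≤ n → suc k * ∣ c (3 + t) n δ - g (3 + t) n δ ∣ ≤ g (3 + t) n δ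
  bound n N≤n = *-cancelʳ-≤ _ _ (labellings n) {{>-nonZero (*-mono-≤ (Perms-nonempty n) (Perms-nonempty n))}}
    -- Cancelling `M` needs it nonzero, which holds by computation because `δ = suc δ′`.
    (*-cancelʳ-≤ _ _ M (begin
      suc k * ∣ c (3 + t) n δ - g (3 + t) n δ ∣ * labellings n * M
        ≡⟨ cong (_* M) (*-assoc (suc k) ∣ c (3 + t) n δ - g (3 + t) n δ ∣ (labellings n)) ⟩
      suc k * (∣ c (3 + t) n δ - g (3 + t) n δ ∣ * labellings n) * M
        ≡⟨ cong (λ m → suc k * m * M) (difference t n δ) ⟩
      suc k * length nonSYK * M        ≡⟨ cong (_* M) (*-comm (suc k) (length nonSYK)) ⟩
      length nonSYK * suc k * M        ≡⟨ *-assoc (length nonSYK) (suc k) M ⟩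
      length nonSYK * (suc k * M)
        ≤⟨ *-monoʳ-≤ (length nonSYK) (≤-trans (≤-reflexive (sym (m+n∸m≡n (2 * δ) (suc k * M))))
            (∸-monoˡ-≤ (2 * δ) N≤n)) ⟩
      length nonSYK * (n ∸ 2 * δ)      ≤⟨ nonSYK-bound ⟩
      length graphs * M                ≡⟨ cong (_* M) (sym (g*labellings t n δ)) ⟩
      g (3 + t) n δ * labellings n * M ∎))
    where
    open ≤-Reasoning
    open Labelled t n δ
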